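{- Let $p$ be a prime and $n$ a positive integer. Let $S\coloneqq\{\mathbf{x}\in\mathbb{Z}_p^n:\ \mathrm{d}(\mathbf{x},\mathbf{1})\le p\sqrt{n}\}$. Then $\chi(\mathsf{Cay}(\mathbb{Z}_p^n,S))\ge \sqrt{n}/p^3$. Furthermore, $\alpha(\mathsf{Cay}(\mathbb{Z}_p^n,S))=\Omega(|\mathbb{Z}_p^n|)$, i.e. for each fixed prime $p$ there is a constant $c_p>0$ such that $\alpha(\mathsf{Cay}(\mathbb{Z}_p^n,S))\ge c_p\,p^n$ for all $n$.
   Context: $\mathbb{Z}_p=\mathbb{Z}/p\mathbb{Z}$; $\mathrm{d}(\cdot,\cdot)$ is the Hamming distance on $\mathbb{Z}_p^n$ (number of coordinates in which two vectors differ) and $\mathbf{1}$ is the all-ones vector. $\mathsf{Cay}(\Gamma,S)$ is the Cayley digraph on vertex set $\Gamma$ with an arc from $u$ to $v$ whenever $v-u\in S$; $\chi$ and $\alpha$ denote the chromatic number and independence number of its underlying undirected graph (distinct $u,v$ adjacent iff $v-u\in S$ or $u-v\in S$). -}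

module Defs where

open import Data.Nat using (ℕ; zero; suc; _+_; _*_; _∸_; _^_; _≤_; NonZero)
open import Data.Nat.DivMod using (_mod_)
open import Data.Fin using (Fin; toℕ)
open import Data.Fin.Properties using () renaming (_≟_ to _≟ᶠ_)
open import Data.Vec using (Vec; []; _∷_; zipWith; replicate)
open import Data.Product using (Σ; _×_)
open import Data.Sum using (_⊎_)
open import Relation.Nullary using (¬_; yes; no)
open import Relation.Binary.PropositionalEquality using (_≡_; _≢_)
open import Function.Definitions using (Injective)

module _ (p : ℕ) .{{_ : NonZero p}} where

  _-ₚ_ : Fin p → Fin p → Fin p
  a -ₚ b = (toℕ a + (p ∸ toℕ b)) mod p

  oneₚ : Fin p
  oneₚ = 1 mod p

  Vtx : ℕ → Set
  Vtx n = Vec (Fin p) n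

  _-ᵥ_ : ∀ {n} → Vtx n → Vtx n → Vtx n
  u -ᵥ v = zipWith _-ₚ_ u v

  𝟏 : ∀ n → Vtx n
  𝟏 n = replicate n oneₚ

  ham : ∀ {n} → Vtx n → Vtx n → ℕ
  ham [] [] = 0
  ham (x ∷ xs) (y ∷ ys) with x ≟ᶠ y
  ... | yes _ = ham xs ys
  ... | no  _ = suc (ham xs ys)

  -- x ∈ S  iff  d(x,1) ≤ p √n  iff  d(x,1)² ≤ p² n   (d(x,1) ≥ 0)
  InS : ∀ n → Vtx n → Set
  InS n x = ham x (𝟏 n) ^ 2 ≤ p ^ 2 * n

  -- adjacency in the underlying undirected graph of Cay(Z_p^n, S)
  Adj : ∀ n → Vtx n → Vtx n → Set
  Adj n u v = u ≢ v × (InS n (v -ᵥ u) ⊎ InS n (u -ᵥ v))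

  Colorable : ℕ → ℕ → Set
  Colorable n k = Σ (Vtx n → Fin k) λ c → ∀ u v → Adj n u v → c u ≢ c v

  IsChromaticNumber : ℕ → ℕ → Set
  IsChromaticNumber n χ = Colorable n χ × (∀ k → Colorable n k → χ ≤ k)

  HasIndependentSet : ℕ → ℕ → Set
  HasIndependentSet n a =
    Σ (Fin a → Vtx n) λ f → Injective _≡_ _≡_ f × (∀ i j → ¬ Adj n (f i) (f j))

  IsIndependenceNumber : ℕ → ℕ → Set
  IsIndependenceNumber n α =
    HasIndependentSet n α × (∀ b → HasIndependentSet n b → b ≤ α)

{-# OPTIONS --safe #-}
-- Chromatic number.  Let T be translation by 𝟏 on V = ℤₚⁿ and c a proper colouring with k colours.
-- The label v ↦ (c (v - v₁𝟏), v₁) ∈ [k] × ℤₚ is T-equivariant, and properness says that a set of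
-- points at pairwise Hamming distance at most p√n never carries both labels (i , j) and (i , j + 1).
-- Hence each colour class of such a set is a proper subset of ℤₚ, and since p is prime ℤₚ acts freely
-- on these label sets (take the mean of a class).  As in Dold's theorem, compare the domain with the
-- target over 𝔽ₚ: zeroing the coordinates one at a time contracts V and raises the diameter of a
-- simplex by only one, so there are chains h₀ , … , h_N with N = kp + 1 and
-- ∂h_{d+1} = (T - 1) h_d or (1 + T + … + Tᵖ⁻¹) h_d alternately.  Freeness yields dual cochains e_d on
-- label lists with ⟨e_{d+1} , h_{d+1}⟩ = ⟨e_d , h_d⟩ and ⟨e₀ , h₀⟩ = 1.  But e_N is alternating on
-- lists of length N > kp, so it vanishes.
--
-- Independence number.  Let Φⱼ(v) count the coordinates of v equal to 1 - j.  If v - w is within d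
-- of 𝟏 then |Φⱼ(v) - Φⱼ₊₁(w)| ≤ d.  So, for g ≥ 2p√n, the vectors with Φⱼ - Φⱼ₊₁ ≥ (p - j) g but
-- Φⱼ₊₁ - Φⱼ₊₂ < (p - j - 1) g form an independent set, and these p sets cover {Φ₀ - Φ₁ ≥ pg}
-- because Φ is p-periodic in j.  The latter has positive density: by Paley–Zygmund the symmetric
-- walk Φ₀ - Φ₁ exceeds a small multiple of its standard deviation with probability at least
-- 1/(8p), and doing so in each of boundedly many blocks of coordinates gives any multiple of √n.
module Submission where

open import Defs
open import Algebra.Bundles using (CommutativeRing)
open import Algebra.Structures using (IsCommutativeRing)
open import Algebra.Consequences.Propositional using (comm∧idˡ⇒id; comm∧invˡ⇒inv; comm∧distrˡ⇒distrʳ)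
import Algebra.Properties.AbelianGroup
import Algebra.Properties.Ring
import Algebra.Solver.Ring
open import Algebra.Solver.Ring.AlmostCommutativeRing using (fromCommutativeRing; _-Raw-AlmostCommutative⟶_)
open import Data.Empty using (⊥; ⊥-elim)
open import Data.Fin using (Fin; toℕ; combine) renaming (zero to fzero; suc to fsuc)
open import Data.Fin.Properties using (toℕ-fromℕ<; toℕ-injective; toℕ<n; toℕ≤n; injective⇒≤; combine-injective) renaming (_≟_ to _≟ᶠ_)
import Data.Integer as ℤ
import Data.Integer.Properties as ℤ
open import Data.List using (List; []; _∷_; _++_; map; length; lookup; allFin; tabulate; filter; cartesianProductWith)
open import Data.List.Membership.Propositional using (_∈_; _∉_)
open import Data.List.Membership.Propositional.Properties using (∈-∃++; ∈-allFin; ∈-map⁻; ∈-lookup; ∈-filter⁻)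
import Data.List.Membership.DecPropositional as DecMembership
open import Data.List.Properties using (map-++; map-id; map-cong; map-∘; length-map; ++-assoc; length-tabulate)
open import Data.List.Relation.Binary.Subset.Propositional using (_⊆_)
open import Data.List.Relation.Binary.Subset.Propositional.Properties using (∷⁺ʳ; xs⊆x∷xs)
open import Data.List.Relation.Unary.All using (All; []; _∷_)
import Data.List.Relation.Unary.All as All
open import Data.List.Relation.Unary.All.Properties using (¬Any⇒All¬; All¬⇒¬Any; tabulate⁺)
open import Data.List.Relation.Unary.AllPairs using ([]; _∷_)
open import Data.List.Relation.Unary.Any using (Any; here; there; any?)
import Data.List.Relation.Unary.Any as Any
open import Data.List.Relation.Unary.Unique.Propositional using (Unique)
import Data.List.Relation.Unary.Unique.Propositional.Properties as Unique
import Data.Maybe as Maybe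
open import Data.Nat using (ℕ; zero; suc; NonZero; _%_; z≤n; s≤s; _<_; _≤_; _∸_; _^_)
import Data.Nat as ℕ
open import Data.Nat.Coprimality using (prime⇒coprime; coprime-Bézout)
open import Data.Nat.DivMod using (_mod_; %-distribˡ-+; %-distribˡ-*; m<n⇒m%n≡m; m%n<n; n%n≡0; [m+kn]%n≡m%n)
open import Data.Nat.GCD using (module Bézout)
open import Data.Nat.ListAction using (sum)
open import Data.Nat.ListAction.Properties using (sum-++)
open import Data.Nat.Primality using (Prime; prime⇒nonTrivial; ¬prime[0]; ¬prime[1])
import Data.Nat.Properties as ℕ
import Data.Nat.Tactic.RingSolver as ℕSolver
open import Data.Product using (Σ; _×_; _,_; ∃; proj₁; proj₂)
open import Data.Product.Properties using (≡-dec)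
open import Data.Sum using (_⊎_; inj₁; inj₂)
open import Data.Unit using (⊤; tt)
open import Data.Vec using ([]; _∷_; head; replicate)
import Data.Vec as Vec
import Data.Vec.Properties as Vec
open import Function using (_∘_; flip)
open import Level using (0ℓ)
open import Relation.Binary.Definitions using (DecidableEquality)
open import Relation.Binary.PropositionalEquality using (_≡_; _≢_; _≗_; refl; sym; trans; cong; cong₂; subst; isEquivalence; module ≡-Reasoning)
open import Relation.Nullary using (¬_; Dec; yes; no)
open import Relation.Nullary.Decidable using (dec⇒maybe; ¬?; _×-dec_)

-- The ring ℤ/p on `Fin p`, its solver, and inverses for prime `p`.

module ModularArithmetic (p : ℕ) .{{_ : NonZero p}} where

  ⟦_⟧ : ℕ → Fin p
  ⟦ m ⟧ = m mod p

  toℕ-⟦⟧ : ∀ m → toℕ ⟦ m ⟧ ≡ m % p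
  toℕ-⟦⟧ m = toℕ-fromℕ< (m%n<n m p)

  ⟦⟧-cong : ∀ m n → m % p ≡ n % p → ⟦ m ⟧ ≡ ⟦ n ⟧
  ⟦⟧-cong m n eq = toℕ-injective (trans (toℕ-⟦⟧ m) (trans eq (sym (toℕ-⟦⟧ n))))

  ⟦⟧-toℕ : ∀ x → ⟦ toℕ x ⟧ ≡ x
  ⟦⟧-toℕ x = toℕ-injective (trans (toℕ-⟦⟧ _) (m<n⇒m%n≡m (toℕ<n x)))

  infixl 6 _+_
  infixl 7 _*_
  infix  8 -_

  0# 1# : Fin p
  0# = ⟦ 0 ⟧
  1# = ⟦ 1 ⟧

  ⟦p⟧≡0 : ⟦ p ⟧ ≡ 0#
  ⟦p⟧≡0 = ⟦⟧-cong p 0 (trans (n%n≡0 p) (sym (m<n⇒m%n≡m (ℕ.>-nonZero⁻¹ p))))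

  abstract
    -- Opaque, so that goals keep the shape the ring solver expects instead of unfolding to `_mod_`;
    -- outside the block only the laws proved here give access.
    _+_ _*_ : Fin p → Fin p → Fin p
    x + y = ⟦ toℕ x ℕ.+ toℕ y ⟧
    x * y = ⟦ toℕ x ℕ.* toℕ y ⟧

    -_ : Fin p → Fin p
    - x = ⟦ p ∸ toℕ x ⟧

    ⟦⟧-+ : ∀ m n → ⟦ m ⟧ + ⟦ n ⟧ ≡ ⟦ m ℕ.+ n ⟧
    ⟦⟧-+ m n = ⟦⟧-cong _ _ (trans (cong₂ (λ a b → (a ℕ.+ b) % p) (toℕ-⟦⟧ m) (toℕ-⟦⟧ n))
                                  (sym (%-distribˡ-+ m n p)))

    ⟦⟧-* : ∀ m n → ⟦ m ⟧ * ⟦ n ⟧ ≡ ⟦ m ℕ.* n ⟧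
    ⟦⟧-* m n = ⟦⟧-cong _ _ (trans (cong₂ (λ a b → (a ℕ.* b) % p) (toℕ-⟦⟧ m) (toℕ-⟦⟧ n))
                                  (sym (%-distribˡ-* m n p)))

    +-assoc : ∀ x y z → (x + y) + z ≡ x + (y + z)
    +-assoc x y z = begin
      (x + y) + z                    ≡⟨ cong (x + y +_) (⟦⟧-toℕ z) ⟨
      (x + y) + ⟦ toℕ z ⟧            ≡⟨ ⟦⟧-+ _ _ ⟩
      ⟦ toℕ x ℕ.+ toℕ y ℕ.+ toℕ z ⟧  ≡⟨ cong ⟦_⟧ (ℕ.+-assoc (toℕ x) (toℕ y) (toℕ z)) ⟩
      ⟦ toℕ x ℕ.+ (toℕ y ℕ.+ toℕ z) ⟧ ≡⟨ ⟦⟧-+ _ _ ⟨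
      ⟦ toℕ x ⟧ + (y + z)            ≡⟨ cong (_+ (y + z)) (⟦⟧-toℕ x) ⟩
      x + (y + z) ∎
      where open ≡-Reasoning

    *-assoc : ∀ x y z → (x * y) * z ≡ x * (y * z)
    *-assoc x y z = begin
      (x * y) * z                    ≡⟨ cong (x * y *_) (⟦⟧-toℕ z) ⟨
      (x * y) * ⟦ toℕ z ⟧            ≡⟨ ⟦⟧-* _ _ ⟩
      ⟦ toℕ x ℕ.* toℕ y ℕ.* toℕ z ⟧  ≡⟨ cong ⟦_⟧ (ℕ.*-assoc (toℕ x) (toℕ y) (toℕ z)) ⟩
      ⟦ toℕ x ℕ.* (toℕ y ℕ.* toℕ z) ⟧ ≡⟨ ⟦⟧-* _ _ ⟨
      ⟦ toℕ x ⟧ * (y * z)            ≡⟨ cong (_* (y * z)) (⟦⟧-toℕ x) ⟩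
      x * (y * z) ∎
      where open ≡-Reasoning

    +-comm : ∀ x y → x + y ≡ y + x
    +-comm x y = cong ⟦_⟧ (ℕ.+-comm (toℕ x) (toℕ y))

    *-comm : ∀ x y → x * y ≡ y * x
    *-comm x y = cong ⟦_⟧ (ℕ.*-comm (toℕ x) (toℕ y))

    +-identityˡ : ∀ x → 0# + x ≡ x
    +-identityˡ x = begin
      0# + x         ≡⟨ cong (0# +_) (⟦⟧-toℕ x) ⟨
      0# + ⟦ toℕ x ⟧ ≡⟨ ⟦⟧-+ 0 (toℕ x) ⟩
      ⟦ toℕ x ⟧      ≡⟨ ⟦⟧-toℕ x ⟩
      x ∎
      where open ≡-Reasoning

    *-identityˡ : ∀ x → 1# * x ≡ x
    *-identityˡ x = begin
      1# * x           ≡⟨ cong (1# *_) (⟦⟧-toℕ x) ⟨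
      1# * ⟦ toℕ x ⟧   ≡⟨ ⟦⟧-* 1 (toℕ x) ⟩
      ⟦ 1 ℕ.* toℕ x ⟧  ≡⟨ cong ⟦_⟧ (ℕ.*-identityˡ (toℕ x)) ⟩
      ⟦ toℕ x ⟧        ≡⟨ ⟦⟧-toℕ x ⟩
      x ∎
      where open ≡-Reasoning

    -‿inverseˡ : ∀ x → (- x) + x ≡ 0#
    -‿inverseˡ x = begin
      (- x) + x          ≡⟨ cong ((- x) +_) (⟦⟧-toℕ x) ⟨
      (- x) + ⟦ toℕ x ⟧  ≡⟨ ⟦⟧-+ _ _ ⟩
      ⟦ p ∸ toℕ x ℕ.+ toℕ x ⟧ ≡⟨ cong ⟦_⟧ (ℕ.m∸n+n≡m (toℕ≤n x)) ⟩
      ⟦ p ⟧              ≡⟨ ⟦p⟧≡0 ⟩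
      0# ∎
      where open ≡-Reasoning

    *-distribˡ-+ : ∀ x y z → x * (y + z) ≡ x * y + x * z
    *-distribˡ-+ x y z = begin
      x * (y + z)          ≡⟨ cong (_* (y + z)) (⟦⟧-toℕ x) ⟨
      ⟦ toℕ x ⟧ * (y + z)  ≡⟨ ⟦⟧-* _ _ ⟩
      ⟦ toℕ x ℕ.* (toℕ y ℕ.+ toℕ z) ⟧ ≡⟨ cong ⟦_⟧ (ℕ.*-distribˡ-+ (toℕ x) (toℕ y) (toℕ z)) ⟩
      ⟦ toℕ x ℕ.* toℕ y ℕ.+ toℕ x ℕ.* toℕ z ⟧ ≡⟨ ⟦⟧-+ _ _ ⟨
      x * y + x * z ∎
      where open ≡-Reasoning

    -ₚ-def : ∀ x y → _-ₚ_ p x y ≡ x + - y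
    -ₚ-def x y = trans (sym (⟦⟧-+ (toℕ x) (p ∸ toℕ y))) (cong (_+ - y) (⟦⟧-toℕ x))

  isCommutativeRing : IsCommutativeRing _≡_ _+_ _*_ -_ 0# 1#
  isCommutativeRing = record
    { isRing = record
      { +-isAbelianGroup = record
        { isGroup = record
          { isMonoid = record
            { isSemigroup = record
              { isMagma = record { isEquivalence = isEquivalence ; ∙-cong = cong₂ _+_ }
              ; assoc = +-assoc }
            ; identity = comm∧idˡ⇒id +-comm +-identityˡ }
          ; inverse = comm∧invˡ⇒inv +-comm -‿inverseˡ
          ; ⁻¹-cong = cong -_ }
        ; comm = +-comm }
      ; *-cong = cong₂ _*_
      ; *-assoc = *-assoc
      ; *-identity = comm∧idˡ⇒id *-comm *-identityˡ
      ; distrib = *-distribˡ-+ , comm∧distrˡ⇒distrʳ *-comm *-distribˡ-+ }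
    ; *-comm = *-comm }

  commutativeRing : CommutativeRing 0ℓ 0ℓ
  commutativeRing = record { isCommutativeRing = isCommutativeRing }

  open CommutativeRing commutativeRing using (-‿inverseʳ; +-identityʳ)
  open Algebra.Properties.Ring (CommutativeRing.ring commutativeRing) using (-‿distribˡ-*; -‿distribʳ-*; -0#≈0#; -‿involutive)
  open Algebra.Properties.AbelianGroup (CommutativeRing.+-abelianGroup commutativeRing) using (⁻¹-∙-comm)

  -- The canonical homomorphism from ℤ: it gives the solver coefficients with decidable equality and
  -- negatives, so that differences cancel.
  fromℤ : ℤ.ℤ → Fin p
  fromℤ (ℤ.+ n)      = ⟦ n ⟧
  fromℤ (ℤ.-[1+ n ]) = - ⟦ suc n ⟧

  fromℤ-neg : ∀ i → fromℤ (ℤ.- i) ≡ - fromℤ i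
  fromℤ-neg (ℤ.+ zero)   = sym -0#≈0#
  fromℤ-neg (ℤ.+ suc n)  = refl
  fromℤ-neg (ℤ.-[1+ n ]) = sym (-‿involutive _)

  fromℤ-⊖ : ∀ m n → fromℤ (m ℤ.⊖ n) ≡ ⟦ m ⟧ + - ⟦ n ⟧
  fromℤ-⊖ m zero = sym (trans (cong (⟦ m ⟧ +_) -0#≈0#) (+-identityʳ _))
  fromℤ-⊖ zero (suc n) = sym (+-identityˡ _)
  fromℤ-⊖ (suc m) (suc n) = begin
    fromℤ (suc m ℤ.⊖ suc n)              ≡⟨ cong fromℤ (ℤ.[1+m]⊖[1+n]≡m⊖n m n) ⟩
    fromℤ (m ℤ.⊖ n)                      ≡⟨ fromℤ-⊖ m n ⟩
    ⟦ m ⟧ + - ⟦ n ⟧                      ≡⟨ cong (_+ - ⟦ n ⟧) (trans (cong (⟦ m ⟧ +_) (-‿inverseʳ 1#)) (+-identityʳ _)) ⟨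
    ⟦ m ⟧ + (1# + - 1#) + - ⟦ n ⟧        ≡⟨ cong (_+ - ⟦ n ⟧) (+-assoc _ _ _) ⟨
    ⟦ m ⟧ + 1# + - 1# + - ⟦ n ⟧          ≡⟨ +-assoc _ _ _ ⟩
    ⟦ m ⟧ + 1# + (- 1# + - ⟦ n ⟧)        ≡⟨ cong₂ _+_ (trans (+-comm _ _) (⟦⟧-+ 1 m)) (trans (⁻¹-∙-comm _ _) (cong -_ (⟦⟧-+ 1 n))) ⟩
    ⟦ suc m ⟧ + - ⟦ suc n ⟧              ∎
    where open ≡-Reasoning

  fromℤ-+ : ∀ i j → fromℤ (i ℤ.+ j) ≡ fromℤ i + fromℤ j
  fromℤ-+ (ℤ.+ m) (ℤ.+ n)           = sym (⟦⟧-+ m n)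
  fromℤ-+ (ℤ.+ m) (ℤ.-[1+ n ])      = fromℤ-⊖ m (suc n)
  fromℤ-+ (ℤ.-[1+ m ]) (ℤ.+ n)      = trans (fromℤ-⊖ n (suc m)) (+-comm _ _)
  fromℤ-+ (ℤ.-[1+ m ]) (ℤ.-[1+ n ]) = trans (cong (λ k → - ⟦ suc k ⟧) (sym (ℕ.+-suc m n)))
    (sym (trans (⁻¹-∙-comm _ _) (cong -_ (⟦⟧-+ (suc m) (suc n)))))

  fromℤ-+* : ∀ m j → fromℤ (ℤ.+ m ℤ.* j) ≡ ⟦ m ⟧ * fromℤ j
  fromℤ-+* m (ℤ.+ n)      = trans (cong fromℤ (sym (ℤ.pos-* m n))) (sym (⟦⟧-* m n))
  fromℤ-+* m (ℤ.-[1+ n ]) = begin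
    fromℤ (ℤ.+ m ℤ.* ℤ.-[1+ n ])   ≡⟨ cong fromℤ (ℤ.neg-distribʳ-* (ℤ.+ m) (ℤ.+ suc n)) ⟨
    fromℤ (ℤ.- (ℤ.+ m ℤ.* ℤ.+ suc n)) ≡⟨ fromℤ-neg (ℤ.+ m ℤ.* ℤ.+ suc n) ⟩
    - fromℤ (ℤ.+ m ℤ.* ℤ.+ suc n)  ≡⟨ cong -_ (fromℤ-+* m (ℤ.+ suc n)) ⟩
    - (⟦ m ⟧ * ⟦ suc n ⟧)          ≡⟨ -‿distribʳ-* _ _ ⟩
    ⟦ m ⟧ * - ⟦ suc n ⟧            ∎
    where open ≡-Reasoning

  fromℤ-* : ∀ i j → fromℤ (i ℤ.* j) ≡ fromℤ i * fromℤ j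
  fromℤ-* (ℤ.+ m) j      = fromℤ-+* m j
  fromℤ-* (ℤ.-[1+ m ]) j = begin
    fromℤ (ℤ.-[1+ m ] ℤ.* j)       ≡⟨ cong fromℤ (ℤ.neg-distribˡ-* (ℤ.+ suc m) j) ⟨
    fromℤ (ℤ.- (ℤ.+ suc m ℤ.* j))  ≡⟨ fromℤ-neg (ℤ.+ suc m ℤ.* j) ⟩
    - fromℤ (ℤ.+ suc m ℤ.* j)      ≡⟨ cong -_ (fromℤ-+* (suc m) j) ⟩
    - (⟦ suc m ⟧ * fromℤ j)        ≡⟨ -‿distribˡ-* _ _ ⟩
    - ⟦ suc m ⟧ * fromℤ j          ∎
    where open ≡-Reasoning

  private
    fromℤ-morphism : ℤ.+-*-rawRing -Raw-AlmostCommutative⟶ fromCommutativeRing commutativeRing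
    fromℤ-morphism = record
      { ⟦_⟧ = fromℤ ; +-homo = fromℤ-+ ; *-homo = fromℤ-* ; -‿homo = fromℤ-neg ; 0-homo = refl ; 1-homo = refl }

  module Solver = Algebra.Solver.Ring ℤ.+-*-rawRing (fromCommutativeRing commutativeRing) fromℤ-morphism
    (λ i j → Maybe.map (cong fromℤ) (dec⇒maybe (i ℤ.≟ j)))

  infixl 6 _-_
  _-_ : Fin p → Fin p → Fin p
  x - y = x + - y

  open Solver using (solve; _:=_; _:+_; _:-_; _:*_; con; :-_)

  p×x≡0 : ∀ x → ⟦ p ⟧ * x ≡ 0#
  p×x≡0 x = trans (cong (_* x) ⟦p⟧≡0) (solve 1 (λ x → con (ℤ.+ 0) :* x := con (ℤ.+ 0)) refl x)

  ⟦⟧-suc : ∀ m → ⟦ suc m ⟧ ≡ ⟦ m ⟧ + 1#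
  ⟦⟧-suc m = trans (sym (⟦⟧-+ 1 m)) (+-comm _ _)

  ⟦⟧-injective-< : ∀ {m n} → m < p → n < p → ⟦ m ⟧ ≡ ⟦ n ⟧ → m ≡ n
  ⟦⟧-injective-< {m} {n} m<p n<p eq = begin
    m          ≡⟨ m<n⇒m%n≡m m<p ⟨
    m % p      ≡⟨ toℕ-⟦⟧ m ⟨
    toℕ ⟦ m ⟧  ≡⟨ cong toℕ eq ⟩
    toℕ ⟦ n ⟧  ≡⟨ toℕ-⟦⟧ n ⟩
    n % p      ≡⟨ m<n⇒m%n≡m n<p ⟩
    n ∎
    where open ≡-Reasoning

  +1-injective : ∀ {x y} → x + 1# ≡ y + 1# → x ≡ y
  +1-injective {x} {y} eq = begin
    x            ≡⟨ solve 1 (λ x → x := (x :+ con (ℤ.+ 1)) :- con (ℤ.+ 1)) refl x ⟩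
    x + 1# - 1#  ≡⟨ cong (_- 1#) eq ⟩
    y + 1# - 1#  ≡⟨ solve 1 (λ x → (x :+ con (ℤ.+ 1)) :- con (ℤ.+ 1) := x) refl y ⟩
    y ∎
    where open ≡-Reasoning

  toℕ-0# : toℕ 0# ≡ 0
  toℕ-0# = trans (toℕ-⟦⟧ 0) (m<n⇒m%n≡m (ℕ.>-nonZero⁻¹ p))

  toℕ-+1 : ∀ x → suc (toℕ x) < p → toℕ (x + 1#) ≡ suc (toℕ x)
  toℕ-+1 x x+1<p = begin
    toℕ (x + 1#)             ≡⟨ cong (λ y → toℕ (y + 1#)) (⟦⟧-toℕ x) ⟨
    toℕ (⟦ toℕ x ⟧ + 1#)     ≡⟨ cong toℕ (⟦⟧-suc (toℕ x)) ⟨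
    toℕ ⟦ suc (toℕ x) ⟧      ≡⟨ toℕ-⟦⟧ _ ⟩
    suc (toℕ x) % p          ≡⟨ m<n⇒m%n≡m x+1<p ⟩
    suc (toℕ x)              ∎
    where open ≡-Reasoning

  toℕ-+1-wrap : ∀ x → suc (toℕ x) ≡ p → x + 1# ≡ 0#
  toℕ-+1-wrap x x+1≡p = begin
    x + 1#             ≡⟨ cong (_+ 1#) (⟦⟧-toℕ x) ⟨
    ⟦ toℕ x ⟧ + 1#     ≡⟨ ⟦⟧-suc (toℕ x) ⟨
    ⟦ suc (toℕ x) ⟧    ≡⟨ cong ⟦_⟧ x+1≡p ⟩
    ⟦ p ⟧              ≡⟨ ⟦p⟧≡0 ⟩
    0#                 ∎
    where open ≡-Reasoning

  -- A Bézout identity for `p` and `toℕ x`; its two sign patterns yield `b` or `- b` as the inverse.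
  inverse : Prime p → ∀ x → x ≢ 0# → ∃ λ y → y * x ≡ 1#
  inverse pr x x≢0 with toℕ x in eq
  ... | zero  = ⊥-elim (x≢0 (trans (sym (⟦⟧-toℕ x)) (cong ⟦_⟧ eq)))
  ... | suc m with coprime-Bézout (prime⇒coprime pr (subst (_< p) eq (toℕ<n x)))
  ...   | Bézout.-+ a b e = ⟦ b ⟧ , (begin
    ⟦ b ⟧ * x                ≡⟨ cong (⟦ b ⟧ *_) x≡ ⟩
    ⟦ b ⟧ * ⟦ suc m ⟧        ≡⟨ ⟦⟧-* b (suc m) ⟩
    ⟦ b ℕ.* suc m ⟧          ≡⟨ cong ⟦_⟧ e ⟨
    ⟦ 1 ℕ.+ a ℕ.* p ⟧        ≡⟨ ⟦⟧-cong _ _ ([m+kn]%n≡m%n 1 a p) ⟩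
    1#                       ∎)
    where
      open ≡-Reasoning
      x≡ : x ≡ ⟦ suc m ⟧
      x≡ = trans (sym (⟦⟧-toℕ x)) (cong ⟦_⟧ eq)
  ...   | Bézout.+- a b e = - ⟦ b ⟧ , (begin
    - ⟦ b ⟧ * x                        ≡⟨ cong (- ⟦ b ⟧ *_) x≡ ⟩
    - ⟦ b ⟧ * ⟦ suc m ⟧                ≡⟨ solve 2 (λ b m → (:- b) :* m := con (ℤ.+ 1) :- (con (ℤ.+ 1) :+ b :* m)) refl ⟦ b ⟧ ⟦ suc m ⟧ ⟩
    1# - (1# + ⟦ b ⟧ * ⟦ suc m ⟧)      ≡⟨ cong (λ z → 1# - (1# + z)) (⟦⟧-* b (suc m)) ⟩
    1# - (1# + ⟦ b ℕ.* suc m ⟧)        ≡⟨ cong (λ z → 1# - z) (⟦⟧-+ 1 (b ℕ.* suc m)) ⟩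
    1# - ⟦ 1 ℕ.+ b ℕ.* suc m ⟧         ≡⟨ cong (λ z → 1# - ⟦ z ⟧) e ⟩
    1# - ⟦ a ℕ.* p ⟧                   ≡⟨ cong (λ z → 1# - z) (⟦⟧-cong _ 0 ([m+kn]%n≡m%n 0 a p)) ⟩
    1# - 0#                            ≡⟨ solve 0 (con (ℤ.+ 1) :- con (ℤ.+ 0) := con (ℤ.+ 1)) refl ⟩
    1#                                 ∎)
    where
      open ≡-Reasoning
      x≡ : x ≡ ⟦ suc m ⟧
      x≡ = trans (sym (⟦⟧-toℕ x)) (cong ⟦_⟧ eq)

-- Ordered simplicial cochains over ℤ/p with a cyclic action.

module Cochains (p : ℕ) .{{_ : NonZero p}} where
  open ModularArithmetic p
  open Solver using (solve; _:=_; _:+_; _:-_; con; :-_)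

  Cochain : Set → Set
  Cochain X = List X → Fin p

  x-0≡x : ∀ x → x - 0# ≡ x
  x-0≡x = solve 1 (λ x → x :- con (ℤ.+ 0) := x) refl

  -0≡0 : - 0# ≡ 0#
  -0≡0 = solve 0 (:- con (ℤ.+ 0) := con (ℤ.+ 0)) refl

  x-x≡0 : ∀ x → x - x ≡ 0#
  x-x≡0 = solve 1 (λ x → x :- x := con (ℤ.+ 0)) refl

  -- The coboundary of the augmented complex of ordered simplices:
  -- lists of length d + 1 are d-simplices, and [] is the augmentation.
  δ : ∀ {X} → Cochain X → Cochain X
  δ f []       = 0#
  δ f (x ∷ xs) = f xs - δ (f ∘ (x ∷_)) xs

  private variable
    X Y : Set

  -- The coboundary evaluates `f` only on sublists of `xs`. Identities known just on a family closed
  -- under sublists, such as the valid label lists, therefore survive it.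
  δ-local : ∀ {f g : Cochain X} xs → (∀ ys → ys ⊆ xs → f ys ≡ g ys) → δ f xs ≡ δ g xs
  δ-local []       f≗g = refl
  δ-local (x ∷ xs) f≗g = cong₂ _-_ (f≗g xs (xs⊆x∷xs xs x)) (δ-local xs (λ ys ys⊆ → f≗g (x ∷ ys) (∷⁺ʳ x ys⊆)))

  δ-cong : ∀ {f g : Cochain X} → f ≗ g → δ f ≗ δ g
  δ-cong f≗g xs = δ-local xs (λ ys _ → f≗g ys)

  δ-+ : ∀ (f g : Cochain X) → δ (λ ys → f ys + g ys) ≗ (λ ys → δ f ys + δ g ys)
  δ-+ f g []       = sym (solve 0 (con (ℤ.+ 0) :+ con (ℤ.+ 0) := con (ℤ.+ 0)) refl)
  δ-+ f g (x ∷ xs) = trans (cong₂ _-_ refl (δ-+ (f ∘ (x ∷_)) (g ∘ (x ∷_)) xs))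
    (solve 4 (λ a b c d → (a :+ b) :- (c :+ d) := (a :- c) :+ (b :- d)) refl _ _ _ _)

  δ-‿- : ∀ (f g : Cochain X) → δ (λ ys → f ys - g ys) ≗ (λ ys → δ f ys - δ g ys)
  δ-‿- f g []       = sym (x-0≡x 0#)
  δ-‿- f g (x ∷ xs) = trans (cong₂ _-_ refl (δ-‿- (f ∘ (x ∷_)) (g ∘ (x ∷_)) xs))
    (solve 4 (λ a b c d → (a :- b) :- (c :- d) := (a :- c) :- (b :- d)) refl _ _ _ _)

  δ-neg : ∀ (f : Cochain X) → δ (λ ys → - f ys) ≗ (λ ys → - δ f ys)
  δ-neg f []       = solve 0 (con (ℤ.+ 0) := :- con (ℤ.+ 0)) refl
  δ-neg f (x ∷ xs) = trans (cong₂ _-_ refl (δ-neg (f ∘ (x ∷_)) xs))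
    (solve 2 (λ a b → (:- a) :- (:- b) := :- (a :- b)) refl _ _)

  δ-0 : ∀ {f : Cochain X} xs → (∀ ys → ys ⊆ xs → f ys ≡ 0#) → δ f xs ≡ 0#
  δ-0 []       f≗0 = refl
  δ-0 (x ∷ xs) f≗0 = trans
    (cong₂ _-_ (f≗0 xs (xs⊆x∷xs xs x)) (δ-0 xs (λ ys ys⊆ → f≗0 (x ∷ ys) (∷⁺ʳ x ys⊆)))) (x-0≡x 0#)

  δ-map : ∀ (φ : X → Y) (f : Cochain Y) → δ (f ∘ map φ) ≗ δ f ∘ map φ
  δ-map φ f []       = refl
  δ-map φ f (x ∷ xs) = cong₂ _-_ refl (δ-map φ (f ∘ (φ x ∷_)) xs)

  δδ : ∀ (f : Cochain X) xs → δ (δ f) xs ≡ 0#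
  δδ f []       = refl
  δδ f (x ∷ xs) = begin
    δ f xs - δ (λ ys → f ys - δ (f ∘ (x ∷_)) ys) xs  ≡⟨ cong₂ _-_ refl (δ-‿- f (δ (f ∘ (x ∷_))) xs) ⟩
    δ f xs - (δ f xs - δ (δ (f ∘ (x ∷_))) xs)        ≡⟨ cong (λ z → δ f xs - (δ f xs - z)) (δδ (f ∘ (x ∷_)) xs) ⟩
    δ f xs - (δ f xs - 0#)                           ≡⟨ solve 1 (λ a → a :- (a :- con (ℤ.+ 0)) := con (ℤ.+ 0)) refl _ ⟩
    0# ∎
    where open ≡-Reasoning

  -- Vanishing on degenerate simplices. It is carried beside antisymmetry because for p = 2
  -- antisymmetry does not force a cochain to vanish on repeated vertices.
  Normalised : Cochain X → Set
  Normalised f = ∀ xs x ys → f (xs ++ x ∷ x ∷ ys) ≡ 0#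

  Antisymmetric : Cochain X → Set
  Antisymmetric f = ∀ xs x y ys → f (xs ++ x ∷ y ∷ ys) ≡ - f (xs ++ y ∷ x ∷ ys)

  δ-normalised : ∀ {f : Cochain X} → Normalised f → Normalised (δ f)
  δ-normalised {f = f} n [] x ys = begin
    f (x ∷ ys) - (f (x ∷ ys) - δ (f ∘ (x ∷_) ∘ (x ∷_)) ys)  ≡⟨ cong (λ z → f (x ∷ ys) - (f (x ∷ ys) - z)) (δ-0 ys (λ zs _ → n [] x zs)) ⟩
    f (x ∷ ys) - (f (x ∷ ys) - 0#)                          ≡⟨ solve 1 (λ a → a :- (a :- con (ℤ.+ 0)) := con (ℤ.+ 0)) refl _ ⟩
    0# ∎
    where open ≡-Reasoning
  δ-normalised n (z ∷ xs) x ys =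
    trans (cong₂ _-_ (n xs x ys) (δ-normalised (λ xs → n (z ∷ xs)) xs x ys)) (x-0≡x 0#)

  δ-antisymmetric : ∀ {f : Cochain X} → Antisymmetric f → Antisymmetric (δ f)
  δ-antisymmetric {f = f} a [] x y ys = begin
    f (y ∷ ys) - (f (x ∷ ys) - δ (f ∘ (x ∷_) ∘ (y ∷_)) ys)
      ≡⟨ cong (λ z → f (y ∷ ys) - (f (x ∷ ys) - z)) (trans (δ-cong (a [] x y) ys) (δ-neg _ ys)) ⟩
    f (y ∷ ys) - (f (x ∷ ys) - (- δ (f ∘ (y ∷_) ∘ (x ∷_)) ys))
      ≡⟨ solve 3 (λ a b c → a :- (b :- (:- c)) := :- (b :- (a :- c))) refl _ _ _ ⟩
    - (f (x ∷ ys) - (f (y ∷ ys) - δ (f ∘ (y ∷_) ∘ (x ∷_)) ys)) ∎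
    where open ≡-Reasoning
  δ-antisymmetric a (z ∷ xs) x y ys =
    trans (cong₂ _-_ (a xs x y ys) (δ-antisymmetric (λ xs → a (z ∷ xs)) xs x y ys))
      (solve 2 (λ a b → (:- a) :- (:- b) := :- (a :- b)) refl _ _)

  -- `D` is T - 1 and `N` is 1 + T + ... + Tᵖ⁻¹, the alternating differentials of the periodic
  -- resolution of ℤ/p; `I` occurs only at the augmentation.
  data Op : Set where
    I D N : Op

  next : Op → Op
  next I = D
  next D = N
  next N = D

  module Action {X : Set} (T : X → X) where

    T* : List X → List X
    T* = map T

    partialNorm : ℕ → Cochain X → Cochain X
    partialNorm zero    f σ = 0#
    partialNorm (suc m) f σ = f σ + partialNorm m f (T* σ)

    Q : Op → Cochain X → Cochain X
    Q I f σ = f σ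
    Q D f σ = f (T* σ) - f σ
    Q N f σ = partialNorm p f σ

    T^ : ℕ → List X → List X
    T^ zero    σ = σ
    T^ (suc m) σ = T^ m (T* σ)

    module _ {P : List X → Set} (T-closed : ∀ {σ} → P σ → P (T* σ)) where

      partialNorm-local : ∀ m {f g} → (∀ σ → P σ → f σ ≡ g σ) → ∀ σ → P σ → partialNorm m f σ ≡ partialNorm m g σ
      partialNorm-local zero    f≗g σ Pσ = refl
      partialNorm-local (suc m) f≗g σ Pσ = cong₂ _+_ (f≗g σ Pσ) (partialNorm-local m f≗g (T* σ) (T-closed Pσ))

      Q-local : ∀ op {f g} → (∀ σ → P σ → f σ ≡ g σ) → ∀ σ → P σ → Q op f σ ≡ Q op g σ
      Q-local I f≗g σ Pσ = f≗g σ Pσ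
      Q-local D f≗g σ Pσ = cong₂ _-_ (f≗g (T* σ) (T-closed Pσ)) (f≗g σ Pσ)
      Q-local N f≗g σ Pσ = partialNorm-local p f≗g σ Pσ

      partialNorm-0 : ∀ m {f} → (∀ σ → P σ → f σ ≡ 0#) → ∀ σ → P σ → partialNorm m f σ ≡ 0#
      partialNorm-0 zero    f≗0 σ Pσ = refl
      partialNorm-0 (suc m) f≗0 σ Pσ = trans (cong₂ _+_ (f≗0 σ Pσ) (partialNorm-0 m f≗0 (T* σ) (T-closed Pσ)))
        (+-identityˡ 0#)

      Q-0 : ∀ op {f} → (∀ σ → P σ → f σ ≡ 0#) → ∀ σ → P σ → Q op f σ ≡ 0#
      Q-0 I f≗0 σ Pσ = f≗0 σ Pσ
      Q-0 D f≗0 σ Pσ = trans (cong₂ _-_ (f≗0 (T* σ) (T-closed Pσ)) (f≗0 σ Pσ)) (x-0≡x 0#)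
      Q-0 N f≗0 σ Pσ = partialNorm-0 p f≗0 σ Pσ

    Q-cong : ∀ op {f g} → f ≗ g → Q op f ≗ Q op g
    Q-cong op f≗g σ = Q-local {P = λ σ → σ ≡ σ} (λ _ → refl) op (λ σ _ → f≗g σ) σ refl

    partialNorm-‿- : ∀ m f g → partialNorm m (λ σ → f σ - g σ) ≗ (λ σ → partialNorm m f σ - partialNorm m g σ)
    partialNorm-‿- zero    f g σ = sym (x-0≡x 0#)
    partialNorm-‿- (suc m) f g σ = trans (cong₂ _+_ refl (partialNorm-‿- m f g (T* σ)))
      (solve 4 (λ a b c d → (a :- b) :+ (c :- d) := (a :+ c) :- (b :+ d)) refl _ _ _ _)

    Q-‿- : ∀ op f g → Q op (λ σ → f σ - g σ) ≗ (λ σ → Q op f σ - Q op g σ)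
    Q-‿- I f g σ = refl
    Q-‿- D f g σ = solve 4 (λ a b c d → (a :- b) :- (c :- d) := (a :- c) :- (b :- d)) refl _ _ _ _
    Q-‿- N f g σ = partialNorm-‿- p f g σ

    partialNorm-T* : ∀ m f σ → partialNorm m f (T* σ) ≡ partialNorm m (f ∘ T*) σ
    partialNorm-T* zero    f σ = refl
    partialNorm-T* (suc m) f σ = cong (f (T* σ) +_) (partialNorm-T* m f (T* σ))

    δ-partialNorm : ∀ m f → δ (partialNorm m f) ≗ partialNorm m (δ f)
    δ-partialNorm zero    f σ = δ-0 σ (λ _ _ → refl)
    δ-partialNorm (suc m) f σ = trans (δ-+ f (partialNorm m f ∘ T*) σ)
      (cong (δ f σ +_) (trans (δ-map T (partialNorm m f) σ) (δ-partialNorm m f (T* σ))))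

    δ-Q : ∀ op f → δ (Q op f) ≗ Q op (δ f)
    δ-Q I f σ = refl
    δ-Q D f σ = trans (δ-‿- (f ∘ T*) f σ) (cong (_- δ f σ) (δ-map T f σ))
    δ-Q N f σ = δ-partialNorm p f σ

    partialNorm-telescope : ∀ m f σ → partialNorm m (Q D f) σ ≡ f (T^ m σ) - f σ
    partialNorm-telescope zero    f σ = sym (x-x≡0 _)
    partialNorm-telescope (suc m) f σ = trans (cong₂ _+_ refl (partialNorm-telescope m f (T* σ)))
      (solve 3 (λ a b c → (b :- a) :+ (c :- b) := c :- a) refl _ _ _)

    Q-normalised : ∀ op {f} → Normalised f → Normalised (Q op f)
    Q-normalised op {f} n xs x ys =
      Q-0 {P = λ σ → ∃ λ xs → ∃ λ x → ∃ λ ys → σ ≡ xs ++ x ∷ x ∷ ys}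
        (λ { (xs , x , ys , refl) → map T xs , T x , map T ys , map-++ T xs (x ∷ x ∷ ys) })
        op (λ { σ (xs , x , ys , refl) → n xs x ys }) _ (xs , x , ys , refl)

    module _ (T^p≗id : ∀ σ → T^ p σ ≡ σ) where

      ND≡0 : ∀ f σ → Q N (Q D f) σ ≡ 0#
      ND≡0 f σ = trans (partialNorm-telescope p f σ) (trans (cong (λ τ → f τ - f σ) (T^p≗id σ)) (x-x≡0 _))

      -- Both (T - 1) N and N (T - 1) telescope to Tᵖ - 1 = 0. The pair `I`, `D` is excluded, its
      -- product being T - 1.
      Q-next : ∀ op f σ → op ≢ I → Q op (Q (next op) f) σ ≡ 0#
      Q-next I f σ op≢I with () ← op≢I refl
      Q-next N f σ _ = ND≡0 f σ
      Q-next D f σ _ = begin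
        partialNorm p f (T* σ) - partialNorm p f σ    ≡⟨ cong (_- partialNorm p f σ) (partialNorm-T* p f σ) ⟩
        partialNorm p (f ∘ T*) σ - partialNorm p f σ  ≡⟨ partialNorm-‿- p (f ∘ T*) f σ ⟨
        partialNorm p (Q D f) σ                       ≡⟨ ND≡0 f σ ⟩
        0# ∎
        where open ≡-Reasoning

  module _ {S : X → X} {T : Y → Y} (φ : X → Y) (φ-equivariant : ∀ x → φ (S x) ≡ T (φ x)) where
    private
      module S = Action S
      module T = Action T

    map-equivariant : ∀ σ → map φ (S.T* σ) ≡ T.T* (map φ σ)
    map-equivariant σ = trans (sym (map-∘ σ)) (trans (map-cong φ-equivariant σ) (map-∘ σ))

    partialNorm-map : ∀ m f σ → S.partialNorm m (f ∘ map φ) σ ≡ T.partialNorm m f (map φ σ)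
    partialNorm-map zero    f σ = refl
    partialNorm-map (suc m) f σ = cong (f (map φ σ) +_)
      (trans (partialNorm-map m f (S.T* σ)) (cong (T.partialNorm m f) (map-equivariant σ)))

    Q-map : ∀ op f σ → S.Q op (f ∘ map φ) σ ≡ T.Q op f (map φ σ)
    Q-map I f σ = refl
    Q-map D f σ = cong (λ τ → f τ - f (map φ σ)) (map-equivariant σ)
    Q-map N f σ = partialNorm-map p f σ

  map-normalised : ∀ (φ : X → Y) {f} → Normalised f → Normalised (f ∘ map φ)
  map-normalised φ {f} n xs x ys = trans (cong f (map-++ φ xs (x ∷ x ∷ ys))) (n (map φ xs) (φ x) (map φ ys))

-- Contracting homotopies and the equivariant chains they produce.

module Contractions (p : ℕ) .{{_ : NonZero p}} where
  open ModularArithmetic p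
  open Solver using (solve; _:=_; _:+_; _:-_; con; :-_)
  open Cochains p
  private variable X : Set

  -- Dual of the prism chain Σ (-1)ⁱ [s v₀, ..., s vᵢ, s′ vᵢ, ..., s′ v_d], the homotopy between the
  -- maps induced by `s` and `s′`.
  prism : (s s′ : X → X) → Cochain X → Cochain X
  prism s s′ f []       = 0#
  prism s s′ f (v ∷ vs) = f (s v ∷ s′ v ∷ map s′ vs) - prism s s′ (f ∘ (s v ∷_)) vs

  -- Controls the support of prisms: diameter estimates are later read off from it.
  InImages : (s s′ : X → X) → List X → X → Set
  InImages s s′ σ y = ∃ λ x → x ∈ σ × (y ≡ s x ⊎ y ≡ s′ x)

  module _ (s s′ : X → X) where

    InImages-there : ∀ {v σ y} → InImages s s′ σ y → InImages s s′ (v ∷ σ) y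
    InImages-there (x , x∈ , eq) = x , there x∈ , eq

    map-InImages : ∀ {y} σ → y ∈ map s′ σ → InImages s s′ σ y
    map-InImages (v ∷ σ) (here eq)  = v , here refl , inj₂ eq
    map-InImages (v ∷ σ) (there y∈) = InImages-there (map-InImages σ y∈)

    prism-local : ∀ {f g : Cochain X} σ → (∀ ys → (∀ {y} → y ∈ ys → InImages s s′ σ y) → f ys ≡ g ys) →
                  prism s s′ f σ ≡ prism s s′ g σ
    prism-local []       f≗g = refl
    prism-local (v ∷ σ) f≗g = cong₂ _-_
      (f≗g _ λ { (here eq)          → v , here refl , inj₁ eq
               ; (there (here eq))  → v , here refl , inj₂ eq
               ; (there (there y∈)) → InImages-there (map-InImages σ y∈) })
      (prism-local σ λ ys hit → f≗g _ λ { (here eq) → v , here refl , inj₁ eq ; (there y∈) → InImages-there (hit y∈) })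

    prism-‿- : ∀ (f g : Cochain X) → prism s s′ (λ ys → f ys - g ys) ≗ (λ ys → prism s s′ f ys - prism s s′ g ys)
    prism-‿- f g []       = sym (x-0≡x 0#)
    prism-‿- f g (v ∷ vs) = trans (cong₂ _-_ refl (prism-‿- (f ∘ (s v ∷_)) (g ∘ (s v ∷_)) vs))
      (solve 4 (λ a b c d → (a :- b) :- (c :- d) := (a :- c) :- (b :- d)) refl _ _ _ _)

    prism-0 : ∀ {f : Cochain X} → (∀ ys → f ys ≡ 0#) → ∀ σ → prism s s′ f σ ≡ 0#
    prism-0 f≗0 []       = refl
    prism-0 f≗0 (v ∷ vs) = trans (cong₂ _-_ (f≗0 _) (prism-0 (λ ys → f≗0 (s v ∷ ys)) vs)) (x-0≡x 0#)

    prism-normalised : ∀ {f : Cochain X} → Normalised f → Normalised (prism s s′ f)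
    prism-normalised {f} n [] x ys = trans
      (cong₂ _-_ (n (s x ∷ []) (s′ x) (map s′ ys))
        (trans (cong₂ _-_ (n [] (s x) (s′ x ∷ map s′ ys)) (prism-0 (λ zs → n [] (s x) zs) ys)) (x-0≡x 0#)))
      (x-0≡x 0#)
    prism-normalised {f} n (z ∷ xs) x ys = trans
      (cong₂ _-_
        (trans (cong (λ τ → f (s z ∷ s′ z ∷ τ)) (map-++ s′ xs (x ∷ x ∷ ys))) (n (s z ∷ s′ z ∷ map s′ xs) (s′ x) (map s′ ys)))
        (prism-normalised (λ xs → n (s z ∷ xs)) xs x ys))
      (x-0≡x 0#)

    -- Induction on the list: after the first vertex is peeled off, the terms `P f vs` and
    -- `δ f₂ (map s′ vs)` cancel and the same identity for `f₁` remains.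
    prism-homotopy : ∀ (f : Cochain X) σ →
      δ (prism s s′ f) σ + prism s s′ (δ f) σ ≡ f (map s′ σ) - f (map s σ)
    prism-homotopy f [] = solve 1 (λ a → con (ℤ.+ 0) :+ con (ℤ.+ 0) := a :- a) refl _
    prism-homotopy f (v ∷ vs) = begin
      (P f vs - δ (λ ys → f (s v ∷ s′ v ∷ map s′ ys) - P f₁ ys) vs)
        + ((f (s′ v ∷ map s′ vs) - (f₁ (map s′ vs) - δ f₂ (map s′ vs))) - P (λ ys → f ys - δ f₁ ys) vs)
        ≡⟨ cong₂ (λ a b → (P f vs - a) + ((f (s′ v ∷ map s′ vs) - (f₁ (map s′ vs) - δ f₂ (map s′ vs))) - b))
             (trans (δ-‿- (f₂ ∘ map s′) (P f₁) vs) (cong (_- δ (P f₁) vs) (δ-map s′ f₂ vs)))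
             (prism-‿- f (δ f₁) vs) ⟩
      (P f vs - (δ f₂ (map s′ vs) - δ (P f₁) vs))
        + ((f (s′ v ∷ map s′ vs) - (f₁ (map s′ vs) - δ f₂ (map s′ vs))) - (P f vs - P (δ f₁) vs))
        ≡⟨ solve 6 (λ a b c d e g → (a :- (b :- c)) :+ ((d :- (e :- b)) :- (a :- g)) := (d :- e) :+ (c :+ g)) refl
             (P f vs) (δ f₂ (map s′ vs)) (δ (P f₁) vs) (f (s′ v ∷ map s′ vs)) (f₁ (map s′ vs)) (P (δ f₁) vs) ⟩
      (f (s′ v ∷ map s′ vs) - f₁ (map s′ vs)) + (δ (P f₁) vs + P (δ f₁) vs)
        ≡⟨ cong₂ _+_ refl (prism-homotopy f₁ vs) ⟩
      (f (s′ v ∷ map s′ vs) - f₁ (map s′ vs)) + (f₁ (map s′ vs) - f₁ (map s vs))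
        ≡⟨ solve 3 (λ a b c → (a :- b) :+ (b :- c) := a :- c) refl _ _ _ ⟩
      f (s′ v ∷ map s′ vs) - f (s v ∷ map s vs) ∎
      where
        open ≡-Reasoning
        P : Cochain X → Cochain X
        P = prism s s′
        f₁ f₂ : Cochain X
        f₁ = f ∘ (s v ∷_)
        f₂ = f₁ ∘ (s′ v ∷_)

  module Contraction {X : Set} (path : ℕ → X → X) (path-0 : ∀ x → path 0 x ≡ x)
                     (end : ℕ) (base : X) (path-end : ∀ x → path end x ≡ base) where

    prisms : ℕ → Cochain X → Cochain X
    prisms zero    f σ = 0#
    prisms (suc m) f σ = prisms m f σ + prism (path m) (path (suc m)) f σ

    prisms-homotopy : ∀ m f σ → δ (prisms m f) σ + prisms m (δ f) σ ≡ f (map (path m) σ) - f σ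
    prisms-homotopy zero f σ = begin
      δ (λ _ → 0#) σ + 0#            ≡⟨ cong (_+ 0#) (δ-0 σ (λ _ _ → refl)) ⟩
      0# + 0#                        ≡⟨ solve 1 (λ a → con (ℤ.+ 0) :+ con (ℤ.+ 0) := a :- a) refl (f σ) ⟩
      f σ - f σ                      ≡⟨ cong (λ τ → f τ - f σ) (trans (map-cong path-0 σ) (map-id σ)) ⟨
      f (map (path 0) σ) - f σ       ∎
      where open ≡-Reasoning
    prisms-homotopy (suc m) f σ = begin
      δ (λ τ → prisms m f τ + P f τ) σ + (prisms m (δ f) σ + P (δ f) σ)  ≡⟨ cong (_+ (prisms m (δ f) σ + P (δ f) σ)) (δ-+ (prisms m f) (P f) σ) ⟩
      (δ (prisms m f) σ + δ (P f) σ) + (prisms m (δ f) σ + P (δ f) σ)    ≡⟨ solve 4 (λ a b c d → (a :+ b) :+ (c :+ d) := (a :+ c) :+ (b :+ d)) refl _ _ _ _ ⟩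
      (δ (prisms m f) σ + prisms m (δ f) σ) + (δ (P f) σ + P (δ f) σ)    ≡⟨ cong₂ _+_ (prisms-homotopy m f σ) (prism-homotopy _ _ f σ) ⟩
      (f (map (path m) σ) - f σ) + (f (map (path (suc m)) σ) - f (map (path m) σ)) ≡⟨ solve 3 (λ a b c → (b :- a) :+ (c :- b) := c :- a) refl _ _ _ ⟩
      f (map (path (suc m)) σ) - f σ ∎
      where
        open ≡-Reasoning
        P = prism (path m) (path (suc m))

    -- The homotopy from the constant map at `base` to zero, dual to sending the empty simplex to
    -- the vertex `base` and all other simplices to zero.
    cone : Cochain X → Cochain X
    cone f []      = f (base ∷ [])
    cone f (_ ∷ _) = 0#

    -- On lists of length at least two the constant map vanishes because f is normalised.
    cone-homotopy : ∀ {f} → Normalised f → ∀ σ → δ (cone f) σ + cone (δ f) σ ≡ f (map (path end) σ)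
    cone-homotopy {f} n [] = solve 1 (λ a → con (ℤ.+ 0) :+ (a :- con (ℤ.+ 0)) := a) refl _
    cone-homotopy {f} n (v ∷ []) = trans
      (solve 1 (λ a → (a :- con (ℤ.+ 0)) :+ con (ℤ.+ 0) := a) refl _) (cong (λ z → f (z ∷ [])) (sym (path-end v)))
    cone-homotopy {f} n (v ∷ w ∷ σ) = begin
      (0# - δ (cone f ∘ (v ∷_)) (w ∷ σ)) + 0#   ≡⟨ cong (λ z → (0# - z) + 0#) (δ-0 (w ∷ σ) (λ _ _ → refl)) ⟩
      (0# - 0#) + 0#                            ≡⟨ solve 0 ((con (ℤ.+ 0) :- con (ℤ.+ 0)) :+ con (ℤ.+ 0) := con (ℤ.+ 0)) refl ⟩
      0#                                        ≡⟨ n [] base (map (path end) σ) ⟨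
      f (base ∷ base ∷ map (path end) σ)        ≡⟨ cong₂ (λ x y → f (x ∷ y ∷ map (path end) σ)) (path-end v) (path-end w) ⟨
      f (map (path end) (v ∷ w ∷ σ))            ∎
      where open ≡-Reasoning

    -- The constant map is homotopic to zero by `cone` and to the identity by `prisms`, so the
    -- difference contracts the normalised augmented complex.
    K : Cochain X → Cochain X
    K f σ = cone f σ - prisms end f σ

    K-homotopy : ∀ {f} → Normalised f → ∀ σ → K (δ f) σ ≡ f σ - δ (K f) σ
    K-homotopy {f} n σ = begin
      c - q                              ≡⟨ solve 4 (λ a b c d → c :- d := ((a :+ c) :- (b :+ d)) :- (a :- b)) refl (δ (cone f) σ) (δ (prisms end f) σ) c q ⟩
      ((δ (cone f) σ + c) - (δ (prisms end f) σ + q)) - (δ (cone f) σ - δ (prisms end f) σ)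
                                         ≡⟨ cong₂ _-_ (cong₂ _-_ (cone-homotopy n σ) (prisms-homotopy end f σ)) (sym (δ-‿- (cone f) (prisms end f) σ)) ⟩
      (f (map (path end) σ) - (f (map (path end) σ) - f σ)) - δ (K f) σ
                                         ≡⟨ cong (_- δ (K f) σ) (solve 2 (λ a b → a :- (a :- b) := b) refl _ _) ⟩
      f σ - δ (K f) σ ∎
      where
        open ≡-Reasoning
        c q : Fin p
        c = cone (δ f) σ
        q = prisms end (δ f) σ

    prisms-‿- : ∀ m f g σ → prisms m (λ τ → f τ - g τ) σ ≡ prisms m f σ - prisms m g σ
    prisms-‿- zero    f g σ = sym (x-0≡x 0#)
    prisms-‿- (suc m) f g σ = trans (cong₂ _+_ (prisms-‿- m f g σ) (prism-‿- _ _ f g σ))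
      (solve 4 (λ a b c d → (a :- b) :+ (c :- d) := (a :+ c) :- (b :+ d)) refl _ _ _ _)

    cone-‿- : ∀ f g σ → cone (λ τ → f τ - g τ) σ ≡ cone f σ - cone g σ
    cone-‿- f g []      = refl
    cone-‿- f g (_ ∷ _) = sym (x-0≡x 0#)

    K-‿- : ∀ f g σ → K (λ τ → f τ - g τ) σ ≡ K f σ - K g σ
    K-‿- f g σ = trans (cong₂ _-_ (cone-‿- f g σ) (prisms-‿- end f g σ))
      (solve 4 (λ a b c d → (a :- b) :- (c :- d) := (a :- c) :- (b :- d)) refl _ _ _ _)

    prisms-normalised : ∀ m {f} → Normalised f → Normalised (prisms m f)
    prisms-normalised zero    n xs x ys = refl
    prisms-normalised (suc m) n xs x ys =
      trans (cong₂ _+_ (prisms-normalised m n xs x ys) (prism-normalised _ _ n xs x ys)) (+-identityˡ 0#)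

    cone-normalised : ∀ f → Normalised (cone f)
    cone-normalised f []       x ys = refl
    cone-normalised f (_ ∷ xs) x ys = refl

    K-normalised : ∀ {f} → Normalised f → Normalised (K f)
    K-normalised {f} n xs x ys =
      trans (cong₂ _-_ (cone-normalised f xs x ys) (prisms-normalised end n xs x ys)) (x-0≡x 0#)

    module _ {P P′ : List X → Set} (P′-base : P′ (base ∷ []))
      (P⇒P′ : ∀ i {σ ys} → P σ → (∀ {y} → y ∈ ys → InImages (path i) (path (suc i)) σ y) → P′ ys) where

      -- A filling evaluates only on `base ∷ []` and on prisms over `σ`, all of which lie in `P′`.
      K-local : ∀ {f g} → (∀ σ → P′ σ → f σ ≡ g σ) → ∀ σ → P σ → K f σ ≡ K g σ
      K-local {f} {g} f≗g σ Pσ = cong₂ _-_ (cone-local σ) (prisms-local end)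
        where
          cone-local : ∀ σ → cone f σ ≡ cone g σ
          cone-local []      = f≗g _ P′-base
          cone-local (_ ∷ _) = refl

          prisms-local : ∀ m → prisms m f σ ≡ prisms m g σ
          prisms-local zero    = refl
          prisms-local (suc m) = cong₂ _+_ (prisms-local m) (prism-local _ _ σ λ ys hit → f≗g ys (P⇒P′ m Pσ hit))

  ops : ℕ → Op
  ops zero    = I
  ops (suc d) = next (ops d)

  ops≢I : ∀ d → ops (suc d) ≢ I
  ops≢I d eq with ops d
  ops≢I d () | I
  ops≢I d () | D
  ops≢I d () | N

  -- An equivariant resolution: H d is the functional "evaluate on h_d", where h_0 = [] and
  -- h_{d+1} is the K-filling of Q (ops d) h_d.
  module Evaluation {X : Set} (path : ℕ → X → X) (path-0 : ∀ x → path 0 x ≡ x)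
                    (end : ℕ) (base : X) (path-end : ∀ x → path end x ≡ base)
                    (T : X → X) (T^p≗id : ∀ σ → Action.T^ T p σ ≡ σ) where
    open Contraction path path-0 end base path-end
    open Action T

    H : ℕ → Cochain X → Fin p
    H zero    f = f []
    H (suc d) f = H d (Q (ops d) (K f))

    module _ {Close : ℕ → List X → Set} (Close-[] : Close 0 []) (Close-base : ∀ r → Close r (base ∷ []))
             (Close-path : ∀ r i {σ ys} → Close r σ → (∀ {y} → y ∈ ys → InImages (path i) (path (suc i)) σ y) → Close (suc r) ys)
             (Close-T : ∀ r {σ} → Close r σ → Close r (T* σ)) where

      -- h_d arises from d fillings, each raising the closeness index by one, so it is supported on
      -- lists in `Close d`.
      H-local : ∀ d {f g} → (∀ σ → Close d σ → f σ ≡ g σ) → H d f ≡ H d g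
      H-local zero    f≗g = f≗g [] Close-[]
      H-local (suc d) f≗g = H-local d (Q-local (Close-T d) (ops d) (K-local (Close-base (suc d)) (Close-path d) f≗g))

    H-cong : ∀ d {f g} → f ≗ g → H d f ≡ H d g
    H-cong d f≗g = H-local {Close = λ _ σ → σ ≡ σ} refl (λ _ → refl) (λ _ _ _ _ → refl) (λ _ _ → refl) d (λ σ _ → f≗g σ)

    H-‿- : ∀ d f g → H d (λ σ → f σ - g σ) ≡ H d f - H d g
    H-‿- zero    f g = refl
    H-‿- (suc d) f g = trans (H-cong d λ σ → trans (Q-cong (ops d) (K-‿- f g) σ) (Q-‿- (ops d) (K f) (K g) σ)) (H-‿- d _ _)

    H-0 : ∀ d → H d (λ _ → 0#) ≡ 0#
    H-0 d = trans (H-cong d (λ _ → sym (x-x≡0 0#))) (trans (H-‿- d (λ _ → 0#) (λ _ → 0#)) (x-x≡0 _))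

    H-filling : ∀ d {g} → Normalised g → H (suc d) (δ g) ≡ H d (Q (ops d) g) - H d (Q (ops d) (δ (K g)))
    H-filling d {g} n = trans (H-cong d λ σ → trans (Q-cong (ops d) (K-homotopy n) σ) (Q-‿- (ops d) g (δ (K g)) σ)) (H-‿- d _ _)

    -- Dually, `Q (ops d)` applied to h_d is a cycle, so it can be filled: its boundary is a product
    -- of two consecutive operators applied to the previous chain.
    H-coboundary : ∀ d {g} → Normalised g → H d (Q (ops d) (δ g)) ≡ 0#
    H-coboundary zero n = refl
    H-coboundary (suc d) {g} n = begin
      H (suc d) (Q (ops (suc d)) (δ g))  ≡⟨ H-cong (suc d) (δ-Q (ops (suc d)) g) ⟨
      H (suc d) (δ G)                    ≡⟨ H-filling d nG ⟩
      H d (Q (ops d) G) - H d (Q (ops d) (δ (K G))) ≡⟨ cong₂ _-_ (QQ d) (H-coboundary d (K-normalised nG)) ⟩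
      0# - 0#                            ≡⟨ x-0≡x 0# ⟩
      0#                                 ∎
      where
        open ≡-Reasoning
        G = Q (ops (suc d)) g
        nG : Normalised G
        nG = Q-normalised (ops (suc d)) n
        QQ : ∀ d → H d (Q (ops d) (Q (ops (suc d)) g)) ≡ 0#
        -- Here the operators are `I` and `D`, whose product is not zero; T - 1 still kills h₀
        -- because T fixes the empty list.
        QQ zero    = x-x≡0 _
        QQ (suc d) = trans (H-cong (suc d) λ σ → Q-next T^p≗id (ops (suc d)) g σ (ops≢I d)) (H-0 (suc d))

    -- On the cycle Q h_d the correction term `δ (K g)` vanishes, which leaves ∂h_{d+1} = Q h_d in
    -- dual form.
    H-step : ∀ d {g} → Normalised g → H (suc d) (δ g) ≡ H d (Q (ops d) g)
    H-step d n = trans (H-filling d n) (trans (cong₂ _-_ refl (H-coboundary d (K-normalised n))) (x-0≡x _))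

-- Repetitions in lists and the pigeonhole principle.

lookup-injective : ∀ {A : Set} {xs : List A} → Unique xs → ∀ {i j} → lookup xs i ≡ lookup xs j → i ≡ j
lookup-injective {xs = x ∷ xs} (x∉ ∷ u) {Fin.zero}  {Fin.zero}  eq = refl
lookup-injective {xs = x ∷ xs} (x∉ ∷ u) {Fin.zero}  {Fin.suc j} eq = ⊥-elim (All.lookup x∉ (∈-lookup j) eq)
lookup-injective {xs = x ∷ xs} (x∉ ∷ u) {Fin.suc i} {Fin.zero}  eq = ⊥-elim (All.lookup x∉ (∈-lookup i) (sym eq))
lookup-injective {xs = x ∷ xs} (x∉ ∷ u) {Fin.suc i} {Fin.suc j} eq = cong Fin.suc (lookup-injective u eq)

Unique⇒length≤ : ∀ {m} {xs : List (Fin m)} → Unique xs → length xs ≤ m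
Unique⇒length≤ u = injective⇒≤ (lookup-injective u)

module _ {A : Set} (_≟_ : DecidableEquality A) where
  open DecMembership _≟_ using (_∈?_)

  Unique⊎Repeated : ∀ xs → Unique xs ⊎ (∃ λ as → ∃ λ x → ∃ λ bs → ∃ λ cs → xs ≡ as ++ x ∷ bs ++ x ∷ cs)
  Unique⊎Repeated [] = inj₁ []
  Unique⊎Repeated (x ∷ xs) with x ∈? xs
  ... | yes x∈xs with bs , cs , refl ← ∈-∃++ x∈xs = inj₂ ([] , x , bs , cs , refl)
  ... | no  x∉xs with Unique⊎Repeated xs
  ...   | inj₁ u = inj₁ (¬Any⇒All¬ xs x∉xs ∷ u)
  ...   | inj₂ (as , y , bs , cs , refl) = inj₂ (x ∷ as , y , bs , cs , refl)

-- The dual cochains on lists of labels.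

module LabelCochains (p : ℕ) .{{_ : NonZero p}} (p-prime : Prime p) (k : ℕ) where
  open ModularArithmetic p
  open Solver using (solve; _:=_; _:+_; _:-_; _:*_; con; :-_)
  open Cochains p
  open Contractions p using (ops; ops≢I)

  module _ {X : Set} {f : Cochain X} (n : Normalised f) (a : Antisymmetric f) where

    -- Adjacent transpositions move the first `x` up to the second and change only the sign.
    alternating-repeated : ∀ as x bs cs → f (as ++ x ∷ bs ++ x ∷ cs) ≡ 0#
    alternating-repeated as x []       cs = n as x cs
    alternating-repeated as x (b ∷ bs) cs = begin
      f (as ++ x ∷ b ∷ bs ++ x ∷ cs)            ≡⟨ a as x b (bs ++ x ∷ cs) ⟩
      - f (as ++ b ∷ x ∷ bs ++ x ∷ cs)          ≡⟨ cong (λ τ → - f τ) (++-assoc as (b ∷ []) (x ∷ bs ++ x ∷ cs)) ⟨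
      - f ((as ++ b ∷ []) ++ x ∷ bs ++ x ∷ cs)  ≡⟨ cong -_ (alternating-repeated (as ++ b ∷ []) x bs cs) ⟩
      - 0#                                      ≡⟨ -0≡0 ⟩
      0# ∎
      where open ≡-Reasoning

  VanishesBelow : {X : Set} → ℕ → Cochain X → Set
  VanishesBelow d f = ∀ xs → length xs < d → f xs ≡ 0#

  δ-vanishesBelow : ∀ {X : Set} d {f : Cochain X} → VanishesBelow d f → VanishesBelow (suc d) (δ f)
  δ-vanishesBelow d       v []       _         = refl
  δ-vanishesBelow (suc d) v (x ∷ xs) (s≤s lt) = trans
    (cong₂ _-_ (v xs lt) (δ-vanishesBelow d (λ ys lt → v (x ∷ ys) (s≤s lt)) xs lt)) (x-0≡x 0#)

  Label : Set
  Label = Fin k × Fin p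

  _≟ˡ_ : DecidableEquality Label
  _≟ˡ_ = ≡-dec _≟ᶠ_ _≟ᶠ_

  Tˡ : Label → Label
  Tˡ (i , j) = i , j + 1#

  open Action Tˡ

  -- A colour class of a valid list cannot be all of ℤ/p; this is the source of freeness.
  Valid : List Label → Set
  Valid τ = ∀ i j → (i , j) ∈ τ → (i , j + 1#) ∉ τ

  Valid-⊆ : ∀ {σ τ} → σ ⊆ τ → Valid τ → Valid σ
  Valid-⊆ σ⊆τ v i j ∈σ ∈σ′ = v i j (σ⊆τ ∈σ) (σ⊆τ ∈σ′)

  Valid-T : ∀ {τ} → Valid τ → Valid (T* τ)
  Valid-T v i j ∈1 ∈2 with ∈-map⁻ Tˡ ∈1 | ∈-map⁻ Tˡ ∈2
  ... | (i , j₁) , ∈τ , refl | (i₂ , j₂) , ∈τ′ , eq with cong proj₁ eq | +1-injective (cong proj₂ eq)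
  ...   | refl | refl = v i j₁ ∈τ ∈τ′

  sumOver : (Label → Fin p) → List Label → Fin p
  sumOver g []      = 0#
  sumOver g (x ∷ τ) = g x + sumOver g τ

  sumOver-swap : ∀ g xs x y ys → sumOver g (xs ++ x ∷ y ∷ ys) ≡ sumOver g (xs ++ y ∷ x ∷ ys)
  sumOver-swap g []       x y ys = solve 3 (λ a b c → a :+ (b :+ c) := b :+ (a :+ c)) refl _ _ _
  sumOver-swap g (z ∷ xs) x y ys = cong (g z +_) (sumOver-swap g xs x y ys)

  indicator : {P : Set} → Dec P → Fin p
  indicator (yes _) = 1#
  indicator (no  _) = 0#

  count total : Fin k → List Label → Fin p
  count i = sumOver (λ (c , j) → indicator (c ≟ᶠ i))
  total i = sumOver (λ (c , j) → indicator (c ≟ᶠ i) * j)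

  count-T : ∀ i τ → count i (T* τ) ≡ count i τ
  count-T i []            = refl
  count-T i ((c , j) ∷ τ) = cong (indicator (c ≟ᶠ i) +_) (count-T i τ)

  total-T : ∀ i τ → total i (T* τ) ≡ total i τ + count i τ
  total-T i []            = sym (+-identityˡ 0#)
  total-T i ((c , j) ∷ τ) = trans (cong (indicator (c ≟ᶠ i) * (j + 1#) +_) (total-T i τ))
    (solve 4 (λ a j t n → a :* (j :+ con (ℤ.+ 1)) :+ (t :+ n) := (a :* j :+ t) :+ (a :+ n)) refl _ _ _ _)

  quotientOr : Fin p → ∀ c → Dec (c ≡ 0#) → Fin p → Fin p
  quotientOr s c (yes _)   r = r
  quotientOr s c (no c≢0) r = s * proj₁ (inverse p-prime c c≢0)

  -- The mean position of the first colour class whose size is a unit of ℤ/p.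
  mean : List (Fin k) → List Label → Fin p
  mean []       τ = 0#
  mean (i ∷ is) τ = quotientOr (total i τ) (count i τ) (count i τ ≟ᶠ 0#) (mean is τ)

  -- Only symmetric sums enter `mean`; through this the potentials inherit antisymmetry.
  mean-swap : ∀ is xs x y ys → mean is (xs ++ x ∷ y ∷ ys) ≡ mean is (xs ++ y ∷ x ∷ ys)
  mean-swap []       xs x y ys = refl
  mean-swap (i ∷ is) xs x y ys
    rewrite sumOver-swap (λ (c , j) → indicator (c ≟ᶠ i)) xs x y ys
          | sumOver-swap (λ (c , j) → indicator (c ≟ᶠ i) * j) xs x y ys
          | mean-swap is xs x y ys = refl

  -- T raises every position by one, so the total of a class grows by its count and the quotient by
  -- one. Counts do not change, so the same class is selected.
  mean-T : ∀ is τ → Any (λ i → count i τ ≢ 0#) is → mean is (T* τ) ≡ mean is τ + 1#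
  mean-T (i ∷ is) τ any rewrite count-T i τ | total-T i τ with count i τ ≟ᶠ 0#
  ... | no c≢0 = trans (*-distribʳ _ (total i τ) (count i τ))
          (cong (total i τ * proj₁ (inverse p-prime _ c≢0) +_) (trans (*-comm _ _) (proj₂ (inverse p-prime _ c≢0))))
    where
      *-distribʳ : ∀ a b c → (b + c) * a ≡ b * a + c * a
      *-distribʳ = solve 3 (λ a b c → (b :+ c) :* a := b :* a :+ c :* a) refl
  ... | yes c≡0 with any
  ...   | here c≢0   = ⊥-elim (c≢0 c≡0)
  ...   | there any′ = mean-T is τ any′

  θ : List Label → Fin p
  θ = mean (allFin k)

  -- The lists on which `θ` is a genuine mean; elsewhere it takes the default 0 and fails to be
  -- equivariant.
  Balanced : List Label → Set
  Balanced τ = Any (λ i → count i τ ≢ 0#) (allFin k)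

  balanced? : ∀ τ → Dec (Balanced τ)
  balanced? τ = any? (λ i → ¬? (count i τ ≟ᶠ 0#)) (allFin k)

  Balanced-T : ∀ τ → Balanced τ → Balanced (T* τ)
  Balanced-T τ = Any.map (λ {i} c≢0 eq → c≢0 (trans (sym (count-T i τ)) eq))

  Balanced-T⁻ : ∀ τ → Balanced (T* τ) → Balanced τ
  Balanced-T⁻ τ = Any.map (λ {i} c≢0 eq → c≢0 (trans (count-T i τ) eq))

  fibre : Fin k → List Label → List (Fin p)
  fibre i [] = []
  fibre i ((c , j) ∷ τ) with c ≟ᶠ i
  ... | yes _ = j ∷ fibre i τ
  ... | no  _ = fibre i τ

  ∈-fibre : ∀ {i j} τ → j ∈ fibre i τ → (i , j) ∈ τ
  ∈-fibre {i} ((c , j) ∷ τ) j∈ with c ≟ᶠ i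
  ∈-fibre ((c , j) ∷ τ) (here refl) | yes refl = here refl
  ∈-fibre ((c , j) ∷ τ) (there j∈)  | yes refl = there (∈-fibre τ j∈)
  ∈-fibre ((c , j) ∷ τ) j∈          | no _     = there (∈-fibre τ j∈)

  fibre-unique : ∀ i {τ} → Unique τ → Unique (fibre i τ)
  fibre-unique i {[]} [] = []
  fibre-unique i {(c , j) ∷ τ} (x∉ ∷ u) with c ≟ᶠ i
  ... | no _     = fibre-unique i u
  ... | yes refl = ¬Any⇒All¬ _ (λ j∈ → All¬⇒¬Any x∉ (∈-fibre τ j∈)) ∷ fibre-unique i u

  count-fibre : ∀ i τ → count i τ ≡ ⟦ length (fibre i τ) ⟧
  count-fibre i [] = refl
  count-fibre i ((c , j) ∷ τ) with c ≟ᶠ i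
  ... | yes _ = trans (cong (1# +_) (count-fibre i τ)) (⟦⟧-+ 1 _)
  ... | no  _ = trans (+-identityˡ _) (count-fibre i τ)

  -- A colour class of a valid list misses a position, so its size is between 1 and p - 1.
  Balanced-valid : ∀ {x τ} → Valid (x ∷ τ) → Unique (x ∷ τ) → Balanced (x ∷ τ)
  Balanced-valid {i , j} {τ} v u = Any.map (λ { refl → c≢0 }) (∈-allFin i)
    where
      js : List (Fin p)
      js = fibre i ((i , j) ∷ τ)

      j∈js : j ∈ js
      j∈js with i ≟ᶠ i
      ... | yes _   = here refl
      ... | no  i≢i = ⊥-elim (i≢i refl)

      length<p : length js < p
      length<p = Unique⇒length≤
        (¬Any⇒All¬ js (λ j+1∈ → v i j (here refl) (∈-fibre ((i , j) ∷ τ) j+1∈)) ∷ fibre-unique i u)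

      nonempty : ∀ {xs : List (Fin p)} → j ∈ xs → length xs ≢ 0
      nonempty (here _)  ()
      nonempty (there _) ()

      c≢0 : count i ((i , j) ∷ τ) ≢ 0#
      c≢0 eq = nonempty j∈js (⟦⟧-injective-< length<p (ℕ.>-nonZero⁻¹ p) (trans (sym (count-fibre i ((i , j) ∷ τ))) eq))

  θ-T : ∀ τ → Balanced τ → θ (T* τ) ≡ θ τ + 1#
  θ-T = mean-T (allFin k)

  whenZero : ∀ {x} → Dec (x ≡ 0#) → Fin p → Fin p
  whenZero (yes _) a = a
  whenZero (no _)  a = 0#

  whenZero-yes : ∀ {x} (d : Dec (x ≡ 0#)) a → x ≡ 0# → whenZero d a ≡ a
  whenZero-yes (yes _)  a eq = refl
  whenZero-yes (no x≢0) a eq = ⊥-elim (x≢0 eq)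

  whenZero-no : ∀ {x} (d : Dec (x ≡ 0#)) a → x ≢ 0# → whenZero d a ≡ 0#
  whenZero-no (yes eq) a x≢0 = ⊥-elim (x≢0 eq)
  whenZero-no (no _)   a x≢0 = refl

  -- A solution w of Q op w = e on valid lists, using θ as an equivariant choice of fundamental domain.
  potentialOf : Op → Cochain Label → Cochain Label
  potentialOf I e τ = e τ
  potentialOf D e τ = - partialNorm (p ∸ toℕ (θ τ)) e τ
  potentialOf N e τ = whenZero (θ τ ≟ᶠ 0#) (e τ)

  -- As N (T - 1) = (T - 1) N = 0, this condition is necessary for Q op w = e; where T acts freely
  -- it is also sufficient.
  Solvable : Op → Cochain Label → Set
  Solvable I e = ⊤
  Solvable D e = ∀ τ → Valid τ → Q N e τ ≡ 0#
  Solvable N e = ∀ τ → Valid τ → Q D e τ ≡ 0#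

  potentialOf-0 : ∀ {P : List Label → Set} → (∀ {τ} → P τ → P (T* τ)) → ∀ op {e} →
    (∀ τ → P τ → e τ ≡ 0#) → ∀ τ → P τ → potentialOf op e τ ≡ 0#
  potentialOf-0 P-T I e≗0 τ Pτ = e≗0 τ Pτ
  potentialOf-0 P-T D e≗0 τ Pτ = trans (cong -_ (partialNorm-0 P-T (p ∸ toℕ (θ τ)) e≗0 τ Pτ)) -0≡0
  potentialOf-0 P-T N e≗0 τ Pτ with θ τ ≟ᶠ 0#
  ... | yes _ = e≗0 τ Pτ
  ... | no  _ = refl

  module _ {e : Cochain Label} where

    -- Up to sign the potential sums `e` from τ to the end of its orbit as measured by `θ`, so
    -- passing to T τ drops exactly e τ. When `θ` wraps from p - 1 to 0 the new sum is the full
    -- norm, which vanishes by `Solvable`.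
    Q-potential-D : Solvable D e → ∀ τ → Valid τ → Balanced τ → Q D (potentialOf D e) τ ≡ e τ
    Q-potential-D solvable τ v b with ℕ.m≤n⇒m<n∨m≡n (toℕ<n (θ τ))
    ... | inj₁ lt = begin
      - partialNorm (p ∸ toℕ (θ (T* τ))) e (T* τ) - (- partialNorm (p ∸ toℕ (θ τ)) e τ)
        ≡⟨ cong₂ (λ m m′ → - partialNorm m e (T* τ) - (- partialNorm m′ e τ))
             (cong (p ∸_) (trans (cong toℕ (θ-T τ b)) (toℕ-+1 (θ τ) lt)))
             (ℕ.+-∸-assoc 1 (toℕ<n (θ τ))) ⟩
      - r - (- (e τ + r))
        ≡⟨ solve 2 (λ r e → (:- r) :- (:- (e :+ r)) := e) refl r (e τ) ⟩
      e τ ∎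
      where
        open ≡-Reasoning
        r = partialNorm (p ∸ suc (toℕ (θ τ))) e (T* τ)
    ... | inj₂ eq = begin
      - partialNorm (p ∸ toℕ (θ (T* τ))) e (T* τ) - (- partialNorm (p ∸ toℕ (θ τ)) e τ)
        ≡⟨ cong₂ (λ m m′ → - partialNorm m e (T* τ) - (- partialNorm m′ e τ))
             (cong (p ∸_) (trans (cong toℕ (trans (θ-T τ b) (toℕ-+1-wrap (θ τ) eq))) toℕ-0#))
             (trans (ℕ.+-∸-assoc 1 (toℕ<n (θ τ))) (cong suc (trans (cong (p ∸_) eq) (ℕ.n∸n≡0 p)))) ⟩
      - partialNorm p e (T* τ) - (- (e τ + 0#))
        ≡⟨ cong (λ z → - z - (- (e τ + 0#))) (solvable (T* τ) (Valid-T v)) ⟩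
      - 0# - (- (e τ + 0#))
        ≡⟨ solve 1 (λ e → (:- con (ℤ.+ 0)) :- (:- (e :+ con (ℤ.+ 0))) := e) refl (e τ) ⟩
      e τ ∎
      where open ≡-Reasoning

    module _ (solvable : Solvable N e) where
      private
        w : Cochain Label
        w = potentialOf N e

        x-y≡0⇒x≡y : ∀ {x y} → x - y ≡ 0# → x ≡ y
        x-y≡0⇒x≡y {x} {y} eq = trans (solve 2 (λ x y → x := (x :- y) :+ y) refl x y) (trans (cong (_+ y) eq) (+-identityˡ y))

        w-off : ∀ τ → 1 ≤ toℕ (θ τ) → w τ ≡ 0#
        w-off τ pos = whenZero-no (θ τ ≟ᶠ 0#) (e τ) (λ eq → ℕ.<⇒≢ pos (sym (trans (cong toℕ eq) toℕ-0#)))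

        w-on : ∀ τ → θ τ ≡ 0# → w τ ≡ e τ
        w-on τ eq = whenZero-yes (θ τ ≟ᶠ 0#) (e τ) eq

      -- While θ + m ≤ p, the m translates stop before `θ` wraps to 0, the only place where `w` can
      -- be nonzero.
      norm-miss : ∀ m τ → Balanced τ → 1 ≤ toℕ (θ τ) → toℕ (θ τ) ℕ.+ m ≤ p → partialNorm m w τ ≡ 0#
      norm-miss zero    τ b pos le = refl
      norm-miss (suc zero) τ b pos le = trans (cong (_+ 0#) (w-off τ pos)) (+-identityˡ 0#)
      norm-miss (suc (suc m)) τ b pos le = trans
        (cong₂ _+_ (w-off τ pos) (norm-miss (suc m) (T* τ) (Balanced-T τ b) (subst (1 ≤_) (sym θT) (s≤s z≤n))
          (subst (λ z → z ℕ.+ suc m ≤ p) (sym θT) (subst (_≤ p) (ℕ.+-suc (toℕ (θ τ)) (suc m)) le))))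
        (+-identityˡ 0#)
        where
          θT : toℕ (θ (T* τ)) ≡ suc (toℕ (θ τ))
          θT = trans (cong toℕ (θ-T τ b)) (toℕ-+1 (θ τ) (ℕ.≤-trans (ℕ.≤-trans (ℕ.≤-reflexive (ℕ.+-comm 2 (toℕ (θ τ)))) (ℕ.+-monoʳ-≤ (toℕ (θ τ)) (s≤s (s≤s z≤n)))) le))

      norm-start : ∀ m τ → Balanced τ → θ τ ≡ 0# → 1 ≤ m → m ≤ p → partialNorm m w τ ≡ e τ
      norm-start (suc zero)    τ b eq _ le = trans (cong (_+ 0#) (w-on τ eq)) (trans (+-comm _ _) (+-identityˡ _))
      norm-start (suc (suc m)) τ b eq _ le = trans
        (cong₂ _+_ (w-on τ eq) (norm-miss (suc m) (T* τ) (Balanced-T τ b)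
          (ℕ.≤-reflexive (sym θT)) (subst (λ z → z ℕ.+ suc m ≤ p) (sym θT) le)))
        (trans (+-comm _ _) (+-identityˡ _))
        where
          θ≡0 : toℕ (θ τ) ≡ 0
          θ≡0 = trans (cong toℕ eq) toℕ-0#
          θT : toℕ (θ (T* τ)) ≡ 1
          θT = trans (cong toℕ (θ-T τ b)) (trans (toℕ-+1 (θ τ)
            (subst (λ z → suc z < p) (sym θ≡0) (ℕ.≤-trans (s≤s (s≤s z≤n)) le))) (cong suc θ≡0))

      -- For p < θ + m the window reaches the translate with θ = 0, and only once since m ≤ p. There
      -- `w` equals `e`, and solvability makes `e` constant along the orbit.
      norm-hit : ∀ m τ → Valid τ → Balanced τ → 1 ≤ toℕ (θ τ) → p < toℕ (θ τ) ℕ.+ m → m ≤ p → partialNorm m w τ ≡ e τ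
      norm-hit zero τ v b pos gt le = ⊥-elim (ℕ.<-asym gt (subst (_< p) (sym (ℕ.+-identityʳ _)) (toℕ<n (θ τ))))
      norm-hit (suc m) τ v b pos gt le = trans (cong₂ _+_ (w-off τ pos) rest) (trans (+-identityˡ _) (x-y≡0⇒x≡y (solvable τ v)))
        where
          gt′ : p < suc (toℕ (θ τ)) ℕ.+ m
          gt′ = subst (p <_) (ℕ.+-suc (toℕ (θ τ)) m) gt

          rest : partialNorm m w (T* τ) ≡ e (T* τ)
          rest with ℕ.m≤n⇒m<n∨m≡n (toℕ<n (θ τ))
          ... | inj₁ lt = norm-hit m (T* τ) (Valid-T v) (Balanced-T τ b)
                            (subst (1 ≤_) (sym θT) (s≤s z≤n)) (subst (λ z → p < z ℕ.+ m) (sym θT) gt′) (ℕ.<⇒≤ le)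
            where
              θT : toℕ (θ (T* τ)) ≡ suc (toℕ (θ τ))
              θT = trans (cong toℕ (θ-T τ b)) (toℕ-+1 (θ τ) lt)
          ... | inj₂ eq = norm-start m (T* τ) (Balanced-T τ b) (trans (θ-T τ b) (toℕ-+1-wrap (θ τ) eq))
                            (ℕ.+-cancelˡ-≤ p 1 m (subst (_≤ p ℕ.+ m) (ℕ.+-comm 1 p) (subst (λ z → p < z ℕ.+ m) eq gt′))) (ℕ.<⇒≤ le)

      Q-potential-N : ∀ τ → Valid τ → Balanced τ → Q N w τ ≡ e τ
      Q-potential-N τ v b with toℕ (θ τ) in eq
      ... | zero  = norm-start p τ b (trans (sym (⟦⟧-toℕ (θ τ))) (cong ⟦_⟧ eq)) (ℕ.>-nonZero⁻¹ p) ℕ.≤-refl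
      ... | suc a = norm-hit p τ v b (subst (1 ≤_) (sym eq) (s≤s z≤n))
                      (subst (λ z → p < z ℕ.+ p) (sym eq) (s≤s (ℕ.m≤n+m p a))) ℕ.≤-refl

    -- Unbalanced valid lists form a T-stable family; since `e` vanishes on it, both sides are zero
    -- whatever `θ` is there.
    Q-potential-unbalanced : ∀ op → (∀ τ → Valid τ → ¬ Balanced τ → e τ ≡ 0#) →
                             ∀ τ → Valid τ → ¬ Balanced τ → Q op (potentialOf op e) τ ≡ e τ
    Q-potential-unbalanced op e≗0 τ v ¬b =
      trans (Q-0 P-T op (potentialOf-0 P-T op (λ τ (v , ¬b) → e≗0 τ v ¬b)) τ (v , ¬b)) (sym (e≗0 τ v ¬b))
      where
        P-T : ∀ {τ} → Valid τ × ¬ Balanced τ → Valid (T* τ) × ¬ Balanced (T* τ)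
        P-T {τ} (v , ¬b) = Valid-T v , ¬b ∘ Balanced-T⁻ τ

    Q-potential : ∀ op → Solvable op e → (∀ τ → Valid τ → ¬ Balanced τ → e τ ≡ 0#) →
                  ∀ τ → Valid τ → Q op (potentialOf op e) τ ≡ e τ
    Q-potential I solvable e≗0 τ v = refl
    Q-potential D solvable e≗0 τ v with balanced? τ
    ... | yes b = Q-potential-D solvable τ v b
    ... | no ¬b = Q-potential-unbalanced D e≗0 τ v ¬b
    Q-potential N solvable e≗0 τ v with balanced? τ
    ... | yes b = Q-potential-N solvable τ v b
    ... | no ¬b = Q-potential-unbalanced N e≗0 τ v ¬b

  partialNorm-antisymmetric : ∀ m {e} → Antisymmetric e → Antisymmetric (partialNorm m e)
  partialNorm-antisymmetric zero    a xs x y ys = sym -0≡0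
  partialNorm-antisymmetric (suc m) {e} a xs x y ys = begin
    e (xs ++ x ∷ y ∷ ys) + partialNorm m e (T* (xs ++ x ∷ y ∷ ys))
      ≡⟨ cong₂ (λ u τ → u + partialNorm m e τ) (a xs x y ys) (map-++ Tˡ xs (x ∷ y ∷ ys)) ⟩
    - e (xs ++ y ∷ x ∷ ys) + partialNorm m e (T* xs ++ Tˡ x ∷ Tˡ y ∷ T* ys)
      ≡⟨ cong₂ _+_ refl (partialNorm-antisymmetric m a (T* xs) (Tˡ x) (Tˡ y) (T* ys)) ⟩
    - e (xs ++ y ∷ x ∷ ys) + - partialNorm m e (T* xs ++ Tˡ y ∷ Tˡ x ∷ T* ys)
      ≡⟨ cong (λ τ → - e (xs ++ y ∷ x ∷ ys) + - partialNorm m e τ) (map-++ Tˡ xs (y ∷ x ∷ ys)) ⟨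
    - e (xs ++ y ∷ x ∷ ys) + - partialNorm m e (T* (xs ++ y ∷ x ∷ ys))
      ≡⟨ solve 2 (λ a b → (:- a) :+ (:- b) := :- (a :+ b)) refl _ _ ⟩
    - (e (xs ++ y ∷ x ∷ ys) + partialNorm m e (T* (xs ++ y ∷ x ∷ ys))) ∎
    where open ≡-Reasoning

  potentialOf-antisymmetric : ∀ op {e} → Antisymmetric e → Antisymmetric (potentialOf op e)
  potentialOf-antisymmetric I a = a
  potentialOf-antisymmetric D {e} a xs x y ys =
    cong -_ (trans (cong (λ t → partialNorm (p ∸ toℕ t) e (xs ++ x ∷ y ∷ ys)) (mean-swap (allFin k) xs x y ys))
      (partialNorm-antisymmetric (p ∸ toℕ (θ (xs ++ y ∷ x ∷ ys))) {e} a xs x y ys))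
  potentialOf-antisymmetric N {e} a xs x y ys
    rewrite mean-swap (allFin k) xs x y ys with θ (xs ++ y ∷ x ∷ ys) ≟ᶠ 0#
  ... | yes _ = a xs x y ys
  ... | no  _ = sym -0≡0

  potentialOf-normalised : ∀ op {e} → Normalised e → Normalised (potentialOf op e)
  potentialOf-normalised op n xs x ys = potentialOf-0
    {P = λ σ → ∃ λ xs → ∃ λ x → ∃ λ ys → σ ≡ xs ++ x ∷ x ∷ ys}
    (λ { (xs , x , ys , refl) → T* xs , Tˡ x , T* ys , map-++ Tˡ xs (x ∷ x ∷ ys) })
    op (λ { σ (xs , x , ys , refl) → n xs x ys }) _ (xs , x , ys , refl)

  potentialOf-vanishesBelow : ∀ op d {e} → VanishesBelow d e → VanishesBelow d (potentialOf op e)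
  potentialOf-vanishesBelow op d v = potentialOf-0 {P = λ σ → length σ < d}
    (λ {τ} lt → subst (_< d) (sym (length-map Tˡ τ)) lt) op v

  isEmpty : Cochain Label
  isEmpty []      = 1#
  isEmpty (_ ∷ _) = 0#

  -- obstruction d is the cochain e_d dual to h_d.
  mutual
    obstruction : ℕ → Cochain Label
    obstruction zero    = isEmpty
    obstruction (suc d) = δ (potential d)

    potential : ℕ → Cochain Label
    potential d = potentialOf (ops d) (obstruction d)

  obstruction-normalised : ∀ d → Normalised (obstruction d)
  obstruction-normalised zero    []       x ys = refl
  obstruction-normalised zero    (_ ∷ xs) x ys = refl
  obstruction-normalised (suc d) = δ-normalised (potentialOf-normalised (ops d) (obstruction-normalised d))

  obstruction-antisymmetric : ∀ d → Antisymmetric (obstruction d)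
  obstruction-antisymmetric zero    []       x y ys = sym -0≡0
  obstruction-antisymmetric zero    (_ ∷ xs) x y ys = sym -0≡0
  obstruction-antisymmetric (suc d) = δ-antisymmetric (potentialOf-antisymmetric (ops d) (obstruction-antisymmetric d))

  obstruction-vanishesBelow : ∀ d → VanishesBelow d (obstruction d)
  obstruction-vanishesBelow zero    xs ()
  obstruction-vanishesBelow (suc d) = δ-vanishesBelow d (potentialOf-vanishesBelow (ops d) d (obstruction-vanishesBelow d))

  -- A valid nonempty list without repetitions is balanced. An unbalanced one thus repeats a label,
  -- where alternating cochains vanish, or is empty and excluded by degree.
  obstruction-unbalanced : ∀ d τ → Valid τ → ¬ Balanced τ → obstruction (suc d) τ ≡ 0#
  obstruction-unbalanced d []      v ¬b = obstruction-vanishesBelow (suc d) [] (s≤s z≤n)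
  obstruction-unbalanced d (x ∷ τ) v ¬b with Unique⊎Repeated _≟ˡ_ (x ∷ τ)
  ... | inj₁ u = ⊥-elim (¬b (Balanced-valid v u))
  ... | inj₂ (as , y , bs , cs , eq) = trans (cong (obstruction (suc d)) eq)
    (alternating-repeated {f = obstruction (suc d)} (obstruction-normalised (suc d)) (obstruction-antisymmetric (suc d)) as y bs cs)

  partialNorm-invariant : ∀ m {e} → (∀ τ → e (T* τ) ≡ e τ) → ∀ τ → partialNorm m e τ ≡ ⟦ m ⟧ * e τ
  partialNorm-invariant zero    {e} inv τ = solve 1 (λ a → con (ℤ.+ 0) := con (ℤ.+ 0) :* a) refl (e τ)
  partialNorm-invariant (suc m) {e} inv τ = begin
    e τ + partialNorm m e (T* τ)  ≡⟨ cong (e τ +_) (trans (partialNorm-invariant m inv (T* τ)) (cong (⟦ m ⟧ *_) (inv τ))) ⟩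
    e τ + ⟦ m ⟧ * e τ             ≡⟨ solve 2 (λ a m → a :+ m :* a := (m :+ con (ℤ.+ 1)) :* a) refl (e τ) ⟦ m ⟧ ⟩
    (⟦ m ⟧ + 1#) * e τ            ≡⟨ cong (_* e τ) (⟦⟧-suc m) ⟨
    ⟦ suc m ⟧ * e τ ∎
    where open ≡-Reasoning

  isEmpty-T : ∀ τ → isEmpty (T* τ) ≡ isEmpty τ
  isEmpty-T []      = refl
  isEmpty-T (_ ∷ _) = refl

  mutual
    -- Write w_d for the potential. In higher degrees Q e_{d+1} = δ (Q w_d) = δ e_d = 0 on valid
    -- lists, as e_d is itself a coboundary. The equality Q w_d = e_d needs solvability one degree
    -- lower, hence the mutual recursion.
    obstruction-solvable : ∀ d → Solvable (ops d) (obstruction d)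
    obstruction-solvable zero = tt
    -- e₁ = δ e₀ is T-invariant, so its norm is p · e₁ = 0.
    obstruction-solvable (suc zero) τ v = trans
      (partialNorm-invariant p (λ τ → trans (sym (δ-map Tˡ isEmpty τ)) (δ-cong isEmpty-T τ)) τ) (p×x≡0 _)
    obstruction-solvable (suc (suc d)) = lem (ops (suc d)) (ops≢I d) (λ τ v → begin
      Q (ops (suc d)) (δ (potential (suc d))) τ  ≡⟨ δ-Q (ops (suc d)) (potential (suc d)) τ ⟨
      δ (Q (ops (suc d)) (potential (suc d))) τ  ≡⟨ δ-local τ (λ σ σ⊆τ → Q-potential-obstruction (suc d) σ (Valid-⊆ σ⊆τ v)) ⟩
      δ (obstruction (suc d)) τ                  ≡⟨ δδ (potential d) τ ⟩
      0# ∎)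
      where
        open ≡-Reasoning
        lem : ∀ op → op ≢ I → ∀ {e} → (∀ τ → Valid τ → Q op e τ ≡ 0#) → Solvable (next op) e
        lem I op≢I with () ← op≢I refl
        lem D op≢I h = h
        lem N op≢I h = h

    Q-potential-obstruction : ∀ d τ → Valid τ → Q (ops d) (potential d) τ ≡ obstruction d τ
    Q-potential-obstruction zero    τ v = refl
    Q-potential-obstruction (suc d) τ v =
      Q-potential (ops (suc d)) (obstruction-solvable (suc d)) (obstruction-unbalanced d) τ v

  Unique⇒length≤k*p : ∀ {τ : List Label} → Unique τ → length τ ≤ k ℕ.* p
  Unique⇒length≤k*p {τ} u = subst (_≤ k ℕ.* p) (length-map (λ (i , j) → combine i j) τ)
    (Unique⇒length≤ (Unique.map⁺ (λ { {i , j} {i′ , j′} eq →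
      let (e₁ , e₂) = combine-injective i j i′ j′ eq in cong₂ _,_ e₁ e₂ }) u))

  -- A list of at most kp labels is too short for the degree, and a longer one repeats a label.
  obstruction-top : ∀ τ → obstruction (suc (k ℕ.* p)) τ ≡ 0#
  obstruction-top τ with length τ ℕ.<? suc (k ℕ.* p) | Unique⊎Repeated _≟ˡ_ τ
  ... | yes lt | _      = obstruction-vanishesBelow _ τ lt
  ... | no ≥N  | inj₁ u = ⊥-elim (≥N (s≤s (Unique⇒length≤k*p u)))
  ... | no _   | inj₂ (as , y , bs , cs , eq) = trans (cong (obstruction (suc (k ℕ.* p))) eq)
    (alternating-repeated {f = obstruction (suc (k ℕ.* p))} (obstruction-normalised (suc (k ℕ.* p))) (obstruction-antisymmetric (suc (k ℕ.* p))) as y bs cs)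

-- Hamming distance under translation, truncation and subtraction.

module Hamming (p : ℕ) .{{_ : NonZero p}} where
  open ModularArithmetic p
  open Solver using (solve; _:=_; _:+_; _:-_; con; :-_)

  private
    H : ∀ {n} → Vtx p n → Vtx p n → ℕ
    H = ham p

  ham-∷-mono : ∀ {m n} x y x′ y′ (xs ys : Vtx p m) (xs′ ys′ : Vtx p n) →
    (x ≡ y → x′ ≡ y′) → H xs′ ys′ ≤ H xs ys → H (x′ ∷ xs′) (y′ ∷ ys′) ≤ H (x ∷ xs) (y ∷ ys)
  ham-∷-mono x y x′ y′ _ _ _ _ imp le with x ≟ᶠ y | x′ ≟ᶠ y′
  ... | yes _   | yes _ = le
  ... | yes x≡y | no ne = ⊥-elim (ne (imp x≡y))
  ... | no _    | yes _ = ℕ.m≤n⇒m≤1+n le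
  ... | no _    | no _  = s≤s le

  ham-∷-≤ : ∀ {n} x y (xs ys : Vtx p n) → H (x ∷ xs) (y ∷ ys) ≤ suc (H xs ys)
  ham-∷-≤ x y xs ys with x ≟ᶠ y
  ... | yes _ = ℕ.n≤1+n _
  ... | no _  = ℕ.≤-refl

  ham-∷-≥ : ∀ {n} x y (xs ys : Vtx p n) → H xs ys ≤ H (x ∷ xs) (y ∷ ys)
  ham-∷-≥ x y xs ys with x ≟ᶠ y
  ... | yes _ = ℕ.≤-refl
  ... | no _  = ℕ.n≤1+n _

  ham-∷-same : ∀ {n} x (xs ys : Vtx p n) → H (x ∷ xs) (x ∷ ys) ≤ H xs ys
  ham-∷-same x xs ys with x ≟ᶠ x
  ... | yes _  = ℕ.≤-refl
  ... | no x≢x = ⊥-elim (x≢x refl)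

  ham-sym-≤ : ∀ {n} (xs ys : Vtx p n) → H xs ys ≤ H ys xs
  ham-sym-≤ []       []       = z≤n
  ham-sym-≤ (x ∷ xs) (y ∷ ys) = ham-∷-mono y x x y ys xs xs ys sym (ham-sym-≤ xs ys)

  ham-refl : ∀ {n} (xs : Vtx p n) → H xs xs ≡ 0
  ham-refl [] = refl
  ham-refl (x ∷ xs) with x ≟ᶠ x
  ... | yes _  = ham-refl xs
  ... | no x≢x = ⊥-elim (x≢x refl)

  translate : ∀ {n} → Fin p → Vtx p n → Vtx p n
  translate a = Vec.map (_+ a)

  translate-translate : ∀ {n} a b (v : Vtx p n) → translate a (translate b v) ≡ translate (b + a) v
  translate-translate a b v = trans (sym (Vec.map-∘ (_+ a) (_+ b) v)) (Vec.map-cong (λ x → +-assoc x b a) v)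

  translate-0 : ∀ {n} (v : Vtx p n) → translate 0# v ≡ v
  translate-0 v = trans (Vec.map-cong (λ x → trans (+-comm x 0#) (+-identityˡ x)) v) (Vec.map-id v)

  ham-translate : ∀ {n} a (v w : Vtx p n) → H (translate a v) (translate a w) ≤ H v w
  ham-translate a []      []      = z≤n
  ham-translate a (x ∷ v) (y ∷ w) = ham-∷-mono x y (x + a) (y + a) v w (translate a v) (translate a w) (cong (_+ a)) (ham-translate a v w)

  truncate : ∀ {n} → ℕ → Vtx p n → Vtx p n
  truncate zero    v       = v
  truncate (suc i) []      = []
  truncate (suc i) (x ∷ v) = 0# ∷ truncate i v

  truncate-all : ∀ {n} (v : Vtx p n) → truncate n v ≡ replicate n 0#
  truncate-all []      = refl
  truncate-all (x ∷ v) = cong (0# ∷_) (truncate-all v)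

  ham-truncate : ∀ {n} i (v w : Vtx p n) → H (truncate i v) (truncate i w) ≤ H v w
  ham-truncate zero    v       w       = ℕ.≤-refl
  ham-truncate (suc i) []      []      = z≤n
  ham-truncate (suc i) (x ∷ v) (y ∷ w) = ham-∷-mono x y 0# 0# v w (truncate i v) (truncate i w) (λ _ → refl) (ham-truncate i v w)

  ham-truncate-suc : ∀ {n} i (v w : Vtx p n) → H (truncate i v) (truncate (suc i) w) ≤ suc (H v w)
  ham-truncate-suc i       []      []      with i
  ... | zero  = z≤n
  ... | suc _ = z≤n
  ham-truncate-suc zero    (x ∷ v) (y ∷ w) = ℕ.≤-trans (ham-∷-≤ x 0# v w) (s≤s (ham-∷-≥ x y v w))
  ham-truncate-suc (suc i) (x ∷ v) (y ∷ w) =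
    ℕ.≤-trans (ham-∷-same 0# (truncate i v) (truncate (suc i) w)) (ℕ.≤-trans (ham-truncate-suc i v w) (s≤s (ham-∷-≥ x y v w)))

  -- Where the vectors agree, (x - a) - (x - (a + 1)) = 1, so only their disagreements keep the
  -- difference away from 𝟏. This turns closeness into adjacency.
  ham-difference : ∀ {n} a (v w : Vtx p n) →
    H (_-ᵥ_ p (translate (- a) v) (translate (- (a + 1#)) w)) (𝟏 p n) ≤ H v w
  ham-difference a []      []      = z≤n
  ham-difference a (x ∷ v) (y ∷ w) = ham-∷-mono x y (_-ₚ_ p (x + - a) (y + - (a + 1#))) 1# v w (_-ᵥ_ p (translate (- a) v) (translate (- (a + 1#)) w)) (𝟏 p _)
    (λ { refl → trans (-ₚ-def _ _)
          (solve 2 (λ x a → (x :+ (:- a)) :- (x :+ (:- (a :+ con (ℤ.+ 1)))) := con (ℤ.+ 1)) refl x a) })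
    (ham-difference a v w)

  -- Used to see that a difference closer than n to 𝟏 comes from distinct vertices, as `Adj`
  -- demands.
  ham-self-difference : 0# ≢ 1# → ∀ {n} (v : Vtx p n) → H (_-ᵥ_ p v v) (𝟏 p n) ≡ n
  ham-self-difference 0≢1 [] = refl
  ham-self-difference 0≢1 (x ∷ v) with _-ₚ_ p x x ≟ᶠ 1#
  ... | no  _  = cong suc (ham-self-difference 0≢1 v)
  ... | yes eq = ⊥-elim (0≢1 (trans (solve 1 (λ x → con (ℤ.+ 0) := x :- x) refl x) (trans (sym (-ₚ-def x x)) eq)))

-- The lower bound for the chromatic number.

module ChromaticNumber (p : ℕ) .{{_ : NonZero p}} (p-prime : Prime p) where
  open ModularArithmetic p
  open Solver using (solve; _:=_; _:+_; _:-_; con; :-_)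
  open Hamming p
  open Cochains p
  open Contractions p

  0≢1 : 0# ≢ 1#
  0≢1 eq with () ← ⟦⟧-injective-< (ℕ.>-nonZero⁻¹ p) (ℕ.nonTrivial⇒n>1 p {{prime⇒nonTrivial p-prime}}) eq

  module Colouring (n k : ℕ) (c : Vtx p (suc n) → Fin k)
                   (proper : ∀ u v → Adj p (suc n) u v → c u ≢ c v)
                   (N<n : suc (k ℕ.* p) < suc n)
                   (N²≤p²n : suc (k ℕ.* p) ^ 2 ≤ p ^ 2 ℕ.* suc n) where
    open LabelCochains p p-prime k

    top : ℕ
    top = suc (k ℕ.* p)

    V : Set
    V = Vtx p (suc n)

    T : V → V
    T = translate 1#

    open Action T using (T*; T^; Q)

    T^-translate : ∀ m σ → T^ m σ ≡ map (translate ⟦ m ⟧) σ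
    T^-translate zero    σ = sym (trans (map-cong translate-0 σ) (map-id σ))
    T^-translate (suc m) σ = begin
      T^ m (map T σ)                       ≡⟨ T^-translate m (map T σ) ⟩
      map (translate ⟦ m ⟧) (map T σ)      ≡⟨ map-∘ σ ⟨
      map (translate ⟦ m ⟧ ∘ T) σ          ≡⟨ map-cong (λ v → trans (translate-translate ⟦ m ⟧ 1# v) (cong (λ a → translate a v) (⟦⟧-+ 1 m))) σ ⟩
      map (translate ⟦ suc m ⟧) σ          ∎
      where open ≡-Reasoning

    T^p≗id : ∀ σ → T^ p σ ≡ σ
    T^p≗id σ = trans (T^-translate p σ) (trans (map-cong (λ v → trans (cong (λ a → translate a v) ⟦p⟧≡0) (translate-0 v)) σ) (map-id σ))

    -- The first coordinate is an equivariant choice of a point in each orbit.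
    label : V → Label
    label v = c (translate (- head v) v) , head v

    label-T : ∀ v → label (T v) ≡ Tˡ (label v)
    label-T v@(x ∷ _) = cong (λ u → c u , x + 1#) (trans (translate-translate _ _ v)
      (cong (λ a → translate a v) (solve 1 (λ x → con (ℤ.+ 1) :+ (:- (x :+ con (ℤ.+ 1))) := :- x) refl x)))

    Close : ℕ → List V → Set
    Close r σ = ∀ {v w} → v ∈ σ → w ∈ σ → ham p v w ≤ r

    Close-base : ∀ r → Close r (replicate (suc n) 0# ∷ [])
    Close-base r (here refl) (here refl) = ℕ.≤-trans (ℕ.≤-reflexive (ham-refl (replicate (suc n) 0#))) z≤n

    Close-path : ∀ r i {σ ys} → Close r σ → (∀ {y} → y ∈ ys → InImages (truncate i) (truncate (suc i)) σ y) → Close (suc r) ys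
    Close-path r i close hit y∈ z∈ with hit y∈ | hit z∈
    ... | v , v∈ , inj₁ refl | w , w∈ , inj₁ refl = ℕ.m≤n⇒m≤1+n (ℕ.≤-trans (ham-truncate i v w) (close v∈ w∈))
    ... | v , v∈ , inj₁ refl | w , w∈ , inj₂ refl = ℕ.≤-trans (ham-truncate-suc i v w) (s≤s (close v∈ w∈))
    ... | v , v∈ , inj₂ refl | w , w∈ , inj₁ refl =
      ℕ.≤-trans (ham-sym-≤ (truncate (suc i) v) (truncate i w)) (ℕ.≤-trans (ham-truncate-suc i w v) (s≤s (close w∈ v∈)))
    ... | v , v∈ , inj₂ refl | w , w∈ , inj₂ refl = ℕ.m≤n⇒m≤1+n (ℕ.≤-trans (ham-truncate (suc i) v w) (close v∈ w∈))

    Close-T : ∀ r {σ} → Close r σ → Close r (T* σ)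
    Close-T r close v∈ w∈ with ∈-map⁻ T v∈ | ∈-map⁻ T w∈
    ... | v , v∈ , refl | w , w∈ , refl = ℕ.≤-trans (ham-translate 1# v w) (close v∈ w∈)

    -- Labels (i , j) and (i , j + 1) on close vertices give representatives of equal colour whose
    -- difference is within `top` of 𝟏. By `N²≤p²n` the difference lies in S, by `N<n` the
    -- representatives are distinct, and properness is violated.
    label-valid : ∀ {r σ} → r ≤ top → Close r σ → Valid (map label σ)
    label-valid {r} {σ} r≤top close i j ∈₁ ∈₂ with ∈-map⁻ label ∈₁ | ∈-map⁻ label ∈₂
    ... | x , x∈ , refl | y , y∈ , eq = proper u′ u (u′≢u , inj₁ (ℕ.≤-trans (ℕ.^-monoˡ-≤ 2 d≤top) N²≤p²n)) same-colour
      where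
        u u′ : V
        u  = translate (- head x) x
        u′ = translate (- (head x + 1#)) y

        d≤top : ham p (_-ᵥ_ p u u′) (𝟏 p (suc n)) ≤ top
        d≤top = ℕ.≤-trans (ham-difference (head x) x y) (ℕ.≤-trans (close x∈ y∈) r≤top)

        u′≢u : u′ ≢ u
        u′≢u eq = ℕ.<⇒≱ N<n (subst (_≤ top) (trans (cong (λ z → ham p (_-ᵥ_ p u z) (𝟏 p (suc n))) eq) (ham-self-difference 0≢1 u)) d≤top)

        same-colour : c u′ ≡ c u
        same-colour = trans (cong (λ a → c (translate (- a) y)) (cong proj₂ eq)) (sym (cong proj₁ eq))

    open Evaluation truncate (λ _ → refl) (suc n) (replicate (suc n) 0#) truncate-all T T^p≗id

    -- With w_d the potential, ⟨δ w_d , h_{d+1}⟩ = ⟨Q w_d , h_d⟩ = ⟨e_d , h_d⟩. The second equality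
    -- holds because h_d is supported on lists of diameter at most d ≤ `top`, whose labels are
    -- valid.
    H-obstruction : ∀ d → d ≤ top → H d (obstruction d ∘ map label) ≡ 1#
    H-obstruction zero    _   = refl
    H-obstruction (suc d) d<N = begin
      H (suc d) (δ (potential d) ∘ map label)      ≡⟨ H-cong (suc d) (δ-map label (potential d)) ⟨
      H (suc d) (δ (potential d ∘ map label))      ≡⟨ H-step d (map-normalised label {potential d} (potentialOf-normalised (ops d) {obstruction d} (obstruction-normalised d))) ⟩
      H d (Q (ops d) (potential d ∘ map label))    ≡⟨ H-local {Close = Close} (λ ()) Close-base Close-path Close-T d (λ σ close →
                                                        trans (Q-map label label-T (ops d) (potential d) σ)
                                                          (Q-potential-obstruction d (map label σ) (label-valid (ℕ.<⇒≤ d<N) close))) ⟩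
      H d (obstruction d ∘ map label)              ≡⟨ H-obstruction d (ℕ.<⇒≤ d<N) ⟩
      1# ∎
      where open ≡-Reasoning

    contradiction : ⊥
    contradiction = 0≢1 (trans (sym (trans (H-cong top (obstruction-top ∘ map label)) (H-0 top))) (H-obstruction top ℕ.≤-refl))

  -- If n > (k p³)², then N = kp + 1 ≤ k p³ satisfies both N < n and N² ≤ p² n, so `Colouring`
  -- applies.
  chromatic-bound : ∀ n → 1 ≤ n → ∀ k → Colorable p n k → n ≤ (k ℕ.* p ^ 3) ^ 2
  chromatic-bound (suc n) _ zero (c , proper) with () ← c (replicate (suc n) 0#)
  chromatic-bound (suc n) _ k@(suc _) (c , proper) = ℕ.≮⇒≥ λ lt →
    Colouring.contradiction n k c proper (ℕ.≤-<-trans N≤ lt) (N²≤ (ℕ.<⇒≤ lt))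
    where
      open ℕ.≤-Reasoning
      q = k ℕ.* p ^ 3

      p>1 : 1 < p
      p>1 = ℕ.nonTrivial⇒n>1 p {{prime⇒nonTrivial p-prime}}

      N≤q : suc (k ℕ.* p) ≤ q
      N≤q = begin
        -- First 1 ≤ kp, then 2p ≤ p³.
        1 ℕ.+ k ℕ.* p          ≤⟨ ℕ.+-monoˡ-≤ (k ℕ.* p) (ℕ.*-mono-≤ {1} {k} (s≤s z≤n) (ℕ.<⇒≤ p>1)) ⟩
        k ℕ.* p ℕ.+ k ℕ.* p    ≡⟨ lem k p ⟩
        k ℕ.* (2 ℕ.* p)        ≤⟨ ℕ.*-monoʳ-≤ k (ℕ.*-mono-≤ p>1 (ℕ.m≤m*n p (p ℕ.* 1) {{ℕ.m*n≢0 p 1}})) ⟩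
        k ℕ.* (p ℕ.* (p ℕ.* (p ℕ.* 1))) ∎
        where
          lem : ∀ k p → k ℕ.* p ℕ.+ k ℕ.* p ≡ k ℕ.* (2 ℕ.* p)
          lem = ℕSolver.solve-∀

      N≤ : suc (k ℕ.* p) ≤ q ^ 2
      N≤ = ℕ.≤-trans N≤q (ℕ.m≤m*n q (q ℕ.* 1) {{ℕ.>-nonZero (ℕ.≤-trans (ℕ.≤-trans (s≤s z≤n) N≤q) (ℕ.≤-reflexive (sym (ℕ.*-identityʳ q))))}})

      N²≤ : q ^ 2 ≤ suc n → suc (k ℕ.* p) ^ 2 ≤ p ^ 2 ℕ.* suc n
      N²≤ q²≤n = begin
        suc (k ℕ.* p) ^ 2     ≤⟨ ℕ.^-monoˡ-≤ 2 N≤q ⟩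
        q ^ 2                 ≤⟨ q²≤n ⟩
        suc n                 ≤⟨ ℕ.m≤n*m (suc n) (p ^ 2) {{ℕ.m^n≢0 p 2}} ⟩
        p ^ 2 ℕ.* suc n       ∎

-- Counting words by the imbalance of two letters.

open import Data.Nat using (_+_; _*_; ∣_-_∣; _≤?_; _<?_; >-nonZero)
open import Data.Nat.Properties
open import Data.Nat.Tactic.RingSolver using (solve-∀)

bit : {A : Set} → Dec A → ℕ
bit (yes _) = 1
bit (no _)  = 0

bit≤1 : ∀ {A : Set} (d : Dec A) → bit d ≤ 1
bit≤1 (yes _) = ≤-refl
bit≤1 (no _)  = z≤n

bit≡1 : ∀ {A : Set} (d : Dec A) → A → bit d ≡ 1
bit≡1 (yes _) a = refl
bit≡1 (no ¬a) a = ⊥-elim (¬a a)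

bit≡0 : ∀ {A : Set} (d : Dec A) → ¬ A → bit d ≡ 0
bit≡0 (yes a) ¬a = ⊥-elim (¬a a)
bit≡0 (no _)  ¬a = refl

bit-≤ : ∀ {A : Set} (d : Dec A) {m} → (A → 1 ≤ m) → bit d ≤ m
bit-≤ (yes a) f = f a
bit-≤ (no _)  f = z≤n

bit-yes : ∀ {A : Set} (d : Dec A) → A → 1 ≤ bit d
bit-yes (yes _) a = s≤s z≤n
bit-yes (no ¬a) a = ⊥-elim (¬a a)

bit-mono : ∀ {A B : Set} (d : Dec A) (d′ : Dec B) → (A → B) → bit d ≤ bit d′
bit-mono d d′ f = bit-≤ d (λ a → bit-yes d′ (f a))

-- walk n g a b is the sum of g (a + #1's) (b + #0's) over all words of length n over an alphabet of q + 2 letters.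
module Walks (q : ℕ) where

  P : ℕ
  P = 2 + q

  walk : ℕ → (ℕ → ℕ → ℕ) → ℕ → ℕ → ℕ
  walk zero    g a b = g a b
  walk (suc n) g a b = walk n g (suc a) b + walk n g a (suc b) + q * walk n g a b

  walk-mono : ∀ n {g h} → (∀ a b → g a b ≤ h a b) → ∀ a b → walk n g a b ≤ walk n h a b
  walk-mono zero    g≤h a b = g≤h a b
  walk-mono (suc n) g≤h a b = +-mono-≤ (+-mono-≤ (walk-mono n g≤h (suc a) b) (walk-mono n g≤h a (suc b))) (*-monoʳ-≤ q (walk-mono n g≤h a b))

  walk-shift : ∀ n {g h} c d → (∀ a b → g a b ≤ h (a + c) (b + d)) → ∀ a b → walk n g a b ≤ walk n h (a + c) (b + d)
  walk-shift zero    c d g≤h a b = g≤h a b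
  walk-shift (suc n) c d g≤h a b = +-mono-≤ (+-mono-≤ (walk-shift n c d g≤h (suc a) b) (walk-shift n c d g≤h a (suc b))) (*-monoʳ-≤ q (walk-shift n c d g≤h a b))

  walk-+ : ∀ n g h a b → walk n (λ a b → g a b + h a b) a b ≡ walk n g a b + walk n h a b
  walk-+ zero    g h a b = refl
  walk-+ (suc n) g h a b = trans (cong₂ (λ x y → x + q * y) (cong₂ _+_ (walk-+ n g h (suc a) b) (walk-+ n g h a (suc b))) (walk-+ n g h a b)) (lem q (walk n g (suc a) b) (walk n h (suc a) b) (walk n g a (suc b)) (walk n h a (suc b)) (walk n g a b) (walk n h a b))
    where
      lem : ∀ q x x′ y y′ z z′ → x + x′ + (y + y′) + q * (z + z′) ≡ x + y + q * z + (x′ + y′ + q * z′)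
      lem = solve-∀

  walk-* : ∀ n c g a b → walk n (λ a b → c * g a b) a b ≡ c * walk n g a b
  walk-* zero    c g a b = refl
  walk-* (suc n) c g a b = trans (cong₂ (λ x y → x + q * y) (cong₂ _+_ (walk-* n c g (suc a) b) (walk-* n c g a (suc b))) (walk-* n c g a b)) (lem q c (walk n g (suc a) b) (walk n g a (suc b)) (walk n g a b))
    where
      lem : ∀ q c x y z → c * x + c * y + q * (c * z) ≡ c * (x + y + q * z)
      lem = solve-∀

  walk-const : ∀ n c a b → walk n (λ _ _ → c) a b ≡ c * P ^ n
  walk-const zero    c a b = sym (*-identityʳ c)
  walk-const (suc n) c a b = trans (cong₂ (λ x y → x + q * y) (cong₂ _+_ (walk-const n c (suc a) b) (walk-const n c a (suc b))) (walk-const n c a b)) (lem q c (P ^ n))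
    where
      lem : ∀ q c x → c * x + c * x + q * (c * x) ≡ c * ((2 + q) * x)
      lem = solve-∀

  walk-flip : ∀ n g a b → walk n (flip g) a b ≡ walk n g b a
  walk-flip zero    g a b = refl
  walk-flip (suc n) g a b = trans (cong₂ (λ x y → x + q * y) (cong₂ _+_ (walk-flip n g (suc a) b) (walk-flip n g a (suc b))) (walk-flip n g a b))
    (cong (_+ q * walk n g b a) (+-comm (walk n g b (suc a)) _))

  walk-++ : ∀ m n g a b → walk (m + n) g a b ≡ walk m (walk n g) a b
  walk-++ zero    n g a b = refl
  walk-++ (suc m) n g a b = cong₂ (λ x y → x + q * y) (cong₂ _+_ (walk-++ m n g (suc a) b) (walk-++ m n g a (suc b))) (walk-++ m n g a b)

  dist² dist⁴ : ℕ → ℕ → ℕ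
  dist² a b = ∣ a - b ∣ * ∣ a - b ∣
  dist⁴ a b = dist² a b * dist² a b

  -- Keeps the moment identities inside ℕ: off the diagonal the two moves change the absolute
  -- difference by 1 in opposite senses, on the diagonal both raise it.
  neighbours : ∀ a b → (∣ a - b ∣ ≡ 0 × ∣ suc a - b ∣ ≡ 1 × ∣ a - suc b ∣ ≡ 1)
    ⊎ (∃ λ c → ∣ a - b ∣ ≡ suc c × ((∣ suc a - b ∣ ≡ c × ∣ a - suc b ∣ ≡ 2 + c) ⊎ (∣ suc a - b ∣ ≡ 2 + c × ∣ a - suc b ∣ ≡ c)))
  neighbours zero          zero          = inj₁ (refl , refl , refl)
  neighbours zero          (suc b)       = inj₂ (b , refl , inj₁ (refl , refl))
  neighbours (suc a)       zero          = inj₂ (a , refl , inj₂ (refl , ∣-∣-identityʳ a))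
  neighbours (suc a)       (suc b)       = neighbours a b

  -- From (x + 1)² + (x - 1)² = 2x² + 2; `dist⁴-step` rests likewise on (x + 1)⁴ + (x - 1)⁴ = 2x⁴ +
  -- 12x² + 2.
  dist²-step : ∀ a b → dist² (suc a) b + dist² a (suc b) + q * dist² a b ≡ P * dist² a b + 2
  dist²-step a b with neighbours a b
  ... | inj₁ (e , e₁ , e₂) rewrite e | e₁ | e₂ = lem q
    where
      lem : ∀ q → 2 + q * 0 ≡ (2 + q) * 0 + 2
      lem = solve-∀
  ... | inj₂ (c , e , inj₁ (e₁ , e₂)) rewrite e | e₁ | e₂ = lem q c
    where
      lem : ∀ q c → c * c + (2 + c) * (2 + c) + q * ((1 + c) * (1 + c)) ≡ (2 + q) * ((1 + c) * (1 + c)) + 2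
      lem = solve-∀
  ... | inj₂ (c , e , inj₂ (e₁ , e₂)) rewrite e | e₁ | e₂ = lem q c
    where
      lem : ∀ q c → (2 + c) * (2 + c) + c * c + q * ((1 + c) * (1 + c)) ≡ (2 + q) * ((1 + c) * (1 + c)) + 2
      lem = solve-∀

  dist⁴-step : ∀ a b → dist⁴ (suc a) b + dist⁴ a (suc b) + q * dist⁴ a b ≡ P * dist⁴ a b + 12 * dist² a b + 2
  dist⁴-step a b with neighbours a b
  ... | inj₁ (e , e₁ , e₂) rewrite e | e₁ | e₂ = lem q
    where
      lem : ∀ q → 2 + q * 0 ≡ (2 + q) * 0 + 12 * 0 + 2
      lem = solve-∀
  ... | inj₂ (c , e , inj₁ (e₁ , e₂)) rewrite e | e₁ | e₂ = lem q c
    where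
      lem : ∀ q c → (c * c) * (c * c) + ((2 + c) * (2 + c)) * ((2 + c) * (2 + c)) + q * (((1 + c) * (1 + c)) * ((1 + c) * (1 + c)))
        ≡ (2 + q) * (((1 + c) * (1 + c)) * ((1 + c) * (1 + c))) + 12 * ((1 + c) * (1 + c)) + 2
      lem = solve-∀
  ... | inj₂ (c , e , inj₂ (e₁ , e₂)) rewrite e | e₁ | e₂ = lem q c
    where
      lem : ∀ q c → ((2 + c) * (2 + c)) * ((2 + c) * (2 + c)) + (c * c) * (c * c) + q * (((1 + c) * (1 + c)) * ((1 + c) * (1 + c)))
        ≡ (2 + q) * (((1 + c) * (1 + c)) * ((1 + c) * (1 + c))) + 12 * ((1 + c) * (1 + c)) + 2
      lem = solve-∀

  -- Each letter adds variance 2/P; denominators are cleared.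
  secondMoment : ∀ n a b → P * walk n dist² a b ≡ P ^ n * (P * dist² a b + 2 * n)
  secondMoment zero a b = lem P (dist² a b)
    where
      lem : ∀ P d → P * d ≡ 1 * (P * d + 0)
      lem = solve-∀
  secondMoment (suc n) a b = begin
    P * (w₁ + w₂ + q * w)                       ≡⟨ lem₁ P q w₁ w₂ w ⟩
    P * w₁ + P * w₂ + q * (P * w)               ≡⟨ cong₂ (λ x y → x + q * y) (cong₂ _+_ (secondMoment n (suc a) b) (secondMoment n a (suc b))) (secondMoment n a b) ⟩
    P ^ n * (P * d₁ + 2 * n) + P ^ n * (P * d₂ + 2 * n) + q * (P ^ n * (P * d + 2 * n))
                                                ≡⟨ lem₂ (P ^ n) q n d₁ d₂ d ⟩
    P ^ n * (P * (d₁ + d₂ + q * d) + P * (2 * n)) ≡⟨ cong (λ x → P ^ n * (P * x + P * (2 * n))) (dist²-step a b) ⟩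
    P ^ n * (P * (P * d + 2) + P * (2 * n))     ≡⟨ lem₃ (P ^ n) P n d ⟩
    P * P ^ n * (P * d + 2 * suc n)             ∎
    where
      open ≡-Reasoning
      w₁ = walk n dist² (suc a) b
      w₂ = walk n dist² a (suc b)
      w  = walk n dist² a b
      d₁ = dist² (suc a) b
      d₂ = dist² a (suc b)
      d  = dist² a b
      lem₁ : ∀ P q x y z → P * (x + y + q * z) ≡ P * x + P * y + q * (P * z)
      lem₁ = solve-∀
      lem₂ : ∀ M q n x y z → M * ((2 + q) * x + 2 * n) + M * ((2 + q) * y + 2 * n) + q * (M * ((2 + q) * z + 2 * n))
             ≡ M * ((2 + q) * (x + y + q * z) + (2 + q) * (2 * n))
      lem₂ = solve-∀
      lem₃ : ∀ M P n d → M * (P * (P * d + 2) + P * (2 * n)) ≡ P * M * (P * d + 2 * (1 + n))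
      lem₃ = solve-∀

  fourthMoment : ∀ n a b → P * P * walk n dist⁴ a b ≤
    P ^ n * (P * P * dist⁴ a b + 12 * n * P * dist² a b + (12 * (n * n) + 2 * n * P))
  fourthMoment zero a b = ≤-reflexive (lem (P * P) P (dist⁴ a b) (dist² a b))
    where
      lem : ∀ PP P d e → PP * d ≡ 1 * (PP * d + 12 * 0 * P * e + (12 * (0 * 0) + 2 * 0 * P))
      lem = solve-∀
  fourthMoment (suc n) a b = begin
    P * P * (w₁ + w₂ + q * w)                       ≡⟨ lem₁ (P * P) q w₁ w₂ w ⟩
    P * P * w₁ + P * P * w₂ + q * (P * P * w)       ≤⟨ +-mono-≤ (+-mono-≤ (fourthMoment n (suc a) b) (fourthMoment n a (suc b))) (*-monoʳ-≤ q (fourthMoment n a b)) ⟩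
    M * (P * P * e₁ + 12 * n * P * d₁ + c) + M * (P * P * e₂ + 12 * n * P * d₂ + c) + q * (M * (P * P * e + 12 * n * P * d + c))
                                                    ≡⟨ lem₂ M q n c d₁ d₂ d e₁ e₂ e ⟩
    M * (P * P * (e₁ + e₂ + q * e) + 12 * n * P * (d₁ + d₂ + q * d) + P * c)
                                                    ≡⟨ cong₂ (λ x y → M * (P * P * x + 12 * n * P * y + P * c)) (dist⁴-step a b) (dist²-step a b) ⟩
    M * (P * P * (P * e + 12 * d + 2) + 12 * n * P * (P * d + 2) + P * c)
                                                    -- The slack completes 12n² + 24n to 12(n + 1)²
                                                    -- and makes the bound an inequality.
                                                    ≤⟨ m≤m+n _ (M * (12 * P)) ⟩
    M * (P * P * (P * e + 12 * d + 2) + 12 * n * P * (P * d + 2) + P * c) + M * (12 * P)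
                                                    ≡⟨ lem₃ M P n d e ⟩
    P * M * (P * P * e + 12 * suc n * P * d + (12 * (suc n * suc n) + 2 * suc n * P)) ∎
    where
      open ≤-Reasoning
      M  = P ^ n
      c  = 12 * (n * n) + 2 * n * P
      w₁ = walk n dist⁴ (suc a) b
      w₂ = walk n dist⁴ a (suc b)
      w  = walk n dist⁴ a b
      d₁ = dist² (suc a) b
      d₂ = dist² a (suc b)
      d  = dist² a b
      e₁ = dist⁴ (suc a) b
      e₂ = dist⁴ a (suc b)
      e  = dist⁴ a b
      lem₁ : ∀ P q x y z → P * (x + y + q * z) ≡ P * x + P * y + q * (P * z)
      lem₁ = solve-∀
      lem₂ : ∀ M q n c x y z u v w → M * ((2 + q) * (2 + q) * u + 12 * n * (2 + q) * x + c) + M * ((2 + q) * (2 + q) * v + 12 * n * (2 + q) * y + c)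
               + q * (M * ((2 + q) * (2 + q) * w + 12 * n * (2 + q) * z + c))
             ≡ M * ((2 + q) * (2 + q) * (u + v + q * w) + 12 * n * (2 + q) * (x + y + q * z) + (2 + q) * c)
      lem₂ = solve-∀
      lem₃ : ∀ M P n d e → M * (P * P * (P * e + 12 * d + 2) + 12 * n * P * (P * d + 2) + P * (12 * (n * n) + 2 * n * P)) + M * (12 * P)
             ≡ P * M * (P * P * e + 12 * (1 + n) * P * d + (12 * ((1 + n) * (1 + n)) + 2 * (1 + n) * P))
      lem₃ = solve-∀

  far ahead : ℕ → ℕ → ℕ → ℕ
  far   t a b = bit (t ≤? ∣ a - b ∣)
  ahead t a b = bit (b + t ≤? a)

  2Bx≤x²+B² : ∀ B x → 2 * B * x ≤ x * x + B * B
  2Bx≤x²+B² zero    x       = z≤n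
  2Bx≤x²+B² (suc B) zero    = ≤-trans (≤-reflexive (*-zeroʳ (2 * suc B))) z≤n
  2Bx≤x²+B² (suc B) (suc x) = begin
    2 * suc B * suc x                          ≡⟨ lem₁ B x ⟩
    2 * B * x + (2 * B + 2 * x + 2)            ≤⟨ +-monoˡ-≤ _ (2Bx≤x²+B² B x) ⟩
    x * x + B * B + (2 * B + 2 * x + 2)        ≡⟨ lem₂ B x ⟩
    suc x * suc x + suc B * suc B              ∎
    where
      open ≤-Reasoning
      lem₁ : ∀ B x → 2 * (1 + B) * (1 + x) ≡ 2 * B * x + (2 * B + 2 * x + 2)
      lem₁ = solve-∀
      lem₂ : ∀ B x → x * x + B * B + (2 * B + 2 * x + 2) ≡ (1 + x) * (1 + x) + (1 + B) * (1 + B)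
      lem₂ = solve-∀

  -- Let x be `dist² a b`. Below imbalance t use x ≤ t², otherwise 2Bx ≤ x² + B²; summed over words
  -- this compares the second moment with the fourth and the number of far words.
  truncation : ∀ B t a b → 2 * B * dist² a b ≤ 2 * B * (t * t) + (dist⁴ a b + B * B * far t a b)
  truncation B t a b with t ≤? ∣ a - b ∣
  ... | yes _ = ≤-trans (2Bx≤x²+B² B (dist² a b)) (≤-trans (+-monoʳ-≤ (dist⁴ a b) (≤-reflexive (sym (*-identityʳ (B * B))))) (m≤n+m _ (2 * B * (t * t))))
  ... | no  t≰ = ≤-trans (*-monoʳ-≤ (2 * B) (*-mono-≤ d≤t d≤t)) (m≤m+n _ _)
    where
      d≤t : ∣ a - b ∣ ≤ t
      d≤t = <⇒≤ (≰⇒> t≰)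

  -- The Paley–Zygmund argument: the second moment is too large, compared with the fourth,
  -- to be carried by words with imbalance below t.
  anticoncentration : ∀ n t → 1 ≤ n → 2 * P * (t * t) ≤ n → P ^ n ≤ 4 * P * walk n (far t) 0 0
  anticoncentration n t 1≤n 2Pt²≤n = *-cancelˡ-≤ (4 * (n * n) * P) {{m*n≢0 (4 * (n * n)) P {{m*n≢0 4 (n * n) {{_}} {{m*n≢0 n n {{n≢0}} {{n≢0}}}}}}}}
    (+-cancelˡ-≤ (12 * (n * n) * P * M) _ _ (begin
      12 * (n * n) * P * M + 4 * (n * n) * P * M      ≡⟨ lem₁ M P n ⟩
      P * (2 * B) * (M * (0 + 2 * n))                 ≡⟨ cong (λ x → P * (2 * B) * (M * (x + 2 * n))) (*-zeroʳ P) ⟨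
      P * (2 * B) * (M * (P * 0 + 2 * n))             ≡⟨ cong (P * (2 * B) *_) (secondMoment n 0 0) ⟨
      P * (2 * B) * (P * m₂)                          ≡⟨ lem₂ P B m₂ ⟩
      P * P * (2 * B * m₂)                            ≤⟨ *-monoʳ-≤ (P * P) summed ⟩
      P * P * (2 * B * (t * t) * M + (m₄ + B * B * F)) ≡⟨ lem₃ P B t M m₄ F ⟩
      B * P * M * (2 * P * (t * t)) + (P * P * m₄ + P * P * (B * B * F)) ≤⟨ +-mono-≤ (*-monoʳ-≤ (B * P * M) 2Pt²≤n) (+-monoˡ-≤ _ m₄≤) ⟩
      B * P * M * n + (M * (8 * (n * n) * P) + P * P * (B * B * F)) ≡⟨ lem₄ P M n F ⟩
      12 * (n * n) * P * M + 4 * (n * n) * P * (4 * P * F) ∎))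
    where
      open ≤-Reasoning
      M = P ^ n
      -- Per word and in units of n²/P, the second moment gives 16, small imbalances take at most 4
      -- and the fourth moment at most 8. The remaining 4 is covered by B² = 16n² times the
      -- proportion of far words.
      B = 4 * n
      m₂ = walk n dist² 0 0
      m₄ = walk n dist⁴ 0 0
      F = walk n (far t) 0 0
      n≢0 : NonZero n
      n≢0 = >-nonZero 1≤n

      summed : 2 * B * m₂ ≤ 2 * B * (t * t) * M + (m₄ + B * B * F)
      summed = begin
        2 * B * m₂                                               ≡⟨ walk-* n (2 * B) dist² 0 0 ⟨
        walk n (λ a b → 2 * B * dist² a b) 0 0                   ≤⟨ walk-mono n (truncation B t) 0 0 ⟩
        walk n (λ a b → 2 * B * (t * t) + (dist⁴ a b + B * B * far t a b)) 0 0
          ≡⟨ walk-+ n (λ _ _ → 2 * B * (t * t)) (λ a b → dist⁴ a b + B * B * far t a b) 0 0 ⟩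
        walk n (λ _ _ → 2 * B * (t * t)) 0 0 + walk n (λ a b → dist⁴ a b + B * B * far t a b) 0 0
          ≡⟨ cong₂ _+_ (walk-const n _ 0 0) (trans (walk-+ n dist⁴ (λ a b → B * B * far t a b) 0 0) (cong (m₄ +_) (walk-* n (B * B) (far t) 0 0))) ⟩
        2 * B * (t * t) * M + (m₄ + B * B * F)                   ∎

      m₄≤ : P * P * m₄ ≤ M * (8 * (n * n) * P)
      m₄≤ = begin
        P * P * m₄                                               ≤⟨ fourthMoment n 0 0 ⟩
        M * (P * P * 0 + 12 * n * P * 0 + (12 * (n * n) + 2 * n * P)) ≡⟨ lem₅ M P n ⟩
        -- Here 2 ≤ P absorbs the first summand and 1 ≤ n the second.
        M * (6 * (n * n) * 2 + 2 * n * 1 * P)                    ≤⟨ *-monoʳ-≤ M (+-mono-≤ (*-monoʳ-≤ (6 * (n * n)) (s≤s (s≤s z≤n))) (*-monoˡ-≤ P (*-monoʳ-≤ (2 * n) 1≤n))) ⟩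
        M * (6 * (n * n) * P + 2 * n * n * P)                    ≡⟨ lem₆ M P n ⟩
        M * (8 * (n * n) * P)                                    ∎
        where
          lem₅ : ∀ M P n → M * (P * P * 0 + 12 * n * P * 0 + (12 * (n * n) + 2 * n * P)) ≡ M * (6 * (n * n) * 2 + 2 * n * 1 * P)
          lem₅ = solve-∀
          lem₆ : ∀ M P n → M * (6 * (n * n) * P + 2 * n * n * P) ≡ M * (8 * (n * n) * P)
          lem₆ = solve-∀

      lem₁ : ∀ M P n → 12 * (n * n) * P * M + 4 * (n * n) * P * M ≡ P * (2 * (4 * n)) * (M * (0 + 2 * n))
      lem₁ = solve-∀
      lem₂ : ∀ P B m → P * (2 * B) * (P * m) ≡ P * P * (2 * B * m)
      lem₂ = solve-∀
      lem₃ : ∀ P B t M m F → P * P * (2 * B * (t * t) * M + (m + B * B * F)) ≡ B * P * M * (2 * P * (t * t)) + (P * P * m + P * P * (B * B * F))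
      lem₃ = solve-∀
      lem₄ : ∀ P M n F → 4 * n * P * M * n + (M * (8 * (n * n) * P) + P * P * (4 * n * (4 * n) * F)) ≡ 12 * (n * n) * P * M + 4 * (n * n) * P * (4 * P * F)
      lem₄ = solve-∀

  lead : ℕ → ℕ → ℕ
  lead n t = walk n (ahead t) 0 0

  far≤2lead : ∀ n t → walk n (far t) 0 0 ≤ 2 * lead n t
  far≤2lead n t = begin
    walk n (far t) 0 0                                   ≤⟨ walk-mono n pointwise 0 0 ⟩
    walk n (λ a b → ahead t a b + ahead t b a) 0 0       ≡⟨ walk-+ n (ahead t) (flip (ahead t)) 0 0 ⟩
    lead n t + walk n (flip (ahead t)) 0 0               ≡⟨ cong (lead n t +_) (walk-flip n (ahead t) 0 0) ⟩
    lead n t + lead n t                                  ≡⟨ cong (lead n t +_) (+-identityʳ _) ⟨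
    2 * lead n t                                         ∎
    where
      open ≤-Reasoning
      pointwise : ∀ a b → far t a b ≤ ahead t a b + ahead t b a
      pointwise a b = bit-≤ (t ≤? ∣ a - b ∣) λ t≤ → case t≤ (≤-total a b)
        where
          case : t ≤ ∣ a - b ∣ → a ≤ b ⊎ b ≤ a → 1 ≤ ahead t a b + ahead t b a
          case t≤ (inj₁ a≤b) = ≤-trans (bit-yes (a + t ≤? b) (≤-trans (+-monoʳ-≤ a (subst (t ≤_) (m≤n⇒∣m-n∣≡n∸m a≤b) t≤)) (≤-reflexive (m+[n∸m]≡n a≤b)))) (m≤n+m _ (ahead t a b))
          case t≤ (inj₂ b≤a) = ≤-trans (bit-yes (b + t ≤? a) (≤-trans (+-monoʳ-≤ b (subst (t ≤_) (m≤n⇒∣n-m∣≡n∸m b≤a) t≤)) (≤-reflexive (m+[n∸m]≡n b≤a)))) (m≤m+n _ (ahead t b a))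

  lead-block : ∀ n t → 1 ≤ n → 2 * P * (t * t) ≤ n → P ^ n ≤ 8 * P * lead n t
  lead-block n t 1≤n le = ≤-trans (anticoncentration n t 1≤n le) (≤-trans (*-monoʳ-≤ (4 * P) (far≤2lead n t)) (≤-reflexive (lem P (lead n t))))
    where
      lem : ∀ P x → 4 * P * (2 * x) ≡ 8 * P * x
      lem = solve-∀

  -- By symmetry at least half of all words have a nonnegative lead; this serves the coordinates
  -- left over by the blocks.
  lead-zero : ∀ n → P ^ n ≤ 2 * lead n 0
  lead-zero n = begin
    P ^ n                        ≡⟨ *-identityˡ _ ⟨
    1 * P ^ n                    ≡⟨ walk-const n 1 0 0 ⟨
    walk n (λ _ _ → 1) 0 0       ≤⟨ walk-mono n (λ a b → bit-yes (0 ≤? ∣ a - b ∣) z≤n) 0 0 ⟩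
    walk n (far 0) 0 0           ≤⟨ far≤2lead n 0 ⟩
    2 * lead n 0                 ∎
    where open ≤-Reasoning

  -- Leads add under concatenation, and the two parts of a word are chosen independently.
  lead-superadditive : ∀ m n s t → lead m s * lead n t ≤ lead (m + n) (s + t)
  lead-superadditive m n s t = begin
    lead m s * lead n t                           ≡⟨ *-comm (lead m s) _ ⟩
    lead n t * lead m s                           ≡⟨ walk-* m (lead n t) (ahead s) 0 0 ⟨
    walk m (λ a b → lead n t * ahead s a b) 0 0   ≤⟨ walk-mono m pointwise 0 0 ⟩
    walk m (walk n (ahead (s + t))) 0 0           ≡⟨ walk-++ m n (ahead (s + t)) 0 0 ⟨
    lead (m + n) (s + t)                          ∎
    where
      open ≤-Reasoning
      pointwise : ∀ a b → lead n t * ahead s a b ≤ walk n (ahead (s + t)) a b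
      pointwise a b with b + s ≤? a
      ... | no  _    = ≤-trans (≤-reflexive (*-zeroʳ (lead n t))) z≤n
      ... | yes b+s≤a = ≤-trans (≤-reflexive (*-identityʳ (lead n t)))
        (walk-shift n a b (λ a′ b′ → bit-mono (b′ + t ≤? a′) (b′ + b + (s + t) ≤? a′ + a) λ b′+t≤a′ →
          ≤-trans (≤-reflexive (lem b′ b s t)) (+-mono-≤ b′+t≤a′ b+s≤a)) 0 0)
        where
          lem : ∀ b′ b s t → b′ + b + (s + t) ≡ b′ + t + (b + s)
          lem = solve-∀

  lead-blocks : ∀ K n t → 1 ≤ n → 2 * P * (t * t) ≤ n → P ^ (K * n) ≤ (8 * P) ^ K * lead (K * n) (K * t)
  lead-blocks zero    n t 1≤n le = s≤s z≤n
  lead-blocks (suc K) n t 1≤n le = begin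
    P ^ (n + K * n)                                             ≡⟨ ^-distribˡ-+-* P n (K * n) ⟩
    P ^ n * P ^ (K * n)                                         ≤⟨ *-mono-≤ (lead-block n t 1≤n le) (lead-blocks K n t 1≤n le) ⟩
    8 * P * lead n t * ((8 * P) ^ K * lead (K * n) (K * t))     ≡⟨ lem (8 * P) ((8 * P) ^ K) (lead n t) (lead (K * n) (K * t)) ⟩
    8 * P * (8 * P) ^ K * (lead n t * lead (K * n) (K * t))     ≤⟨ *-monoʳ-≤ (8 * P * (8 * P) ^ K) (lead-superadditive n (K * n) t (K * t)) ⟩
    8 * P * (8 * P) ^ K * lead (n + K * n) (t + K * t)          ∎
    where
      open ≤-Reasoning
      lem : ∀ x y u v → x * u * (y * v) ≡ x * y * (u * v)
      lem = solve-∀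

-- Finite sums and integer square roots.

module _ {A : Set} where

  sumMap : (A → ℕ) → List A → ℕ
  sumMap f xs = sum (map f xs)

  sumMap-cong : ∀ {f g : A → ℕ} → f ≗ g → ∀ xs → sumMap f xs ≡ sumMap g xs
  sumMap-cong f≗g xs = cong sum (map-cong f≗g xs)

  sumMap-mono : ∀ {f g : A → ℕ} → (∀ x → f x ≤ g x) → ∀ xs → sumMap f xs ≤ sumMap g xs
  sumMap-mono f≤g []       = z≤n
  sumMap-mono f≤g (x ∷ xs) = +-mono-≤ (f≤g x) (sumMap-mono f≤g xs)

  sumMap-+ : ∀ (f g : A → ℕ) xs → sumMap (λ x → f x + g x) xs ≡ sumMap f xs + sumMap g xs
  sumMap-+ f g []       = refl
  sumMap-+ f g (x ∷ xs) = trans (cong (f x + g x +_) (sumMap-+ f g xs)) (lem (f x) (g x) (sumMap f xs) (sumMap g xs))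
    where
      lem : ∀ a b c d → a + b + (c + d) ≡ a + c + (b + d)
      lem = solve-∀

  sumMap-0 : ∀ (xs : List A) → sumMap (λ _ → 0) xs ≡ 0
  sumMap-0 []       = refl
  sumMap-0 (x ∷ xs) = sumMap-0 xs

  length-filter-bit : ∀ {P : A → Set} (P? : ∀ x → Dec (P x)) xs → sumMap (λ x → bit (P? x)) xs ≡ length (filter P? xs)
  length-filter-bit P? [] = refl
  length-filter-bit P? (x ∷ xs) with P? x
  ... | yes _ = cong suc (length-filter-bit P? xs)
  ... | no  _ = length-filter-bit P? xs

sumMap-constant : ∀ {A : Set} {f : A → ℕ} {c} {xs} → All (λ x → f x ≡ c) xs → sumMap f xs ≡ length xs * c
sumMap-constant []         = refl
sumMap-constant (eq ∷ eqs) = cong₂ _+_ eq (sumMap-constant eqs)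

sumTo : ℕ → (ℕ → ℕ) → ℕ
sumTo zero    f = 0
sumTo (suc m) f = f m + sumTo m f

sumTo-≥ : ∀ {m j} f → j < m → f j ≤ sumTo m f
sumTo-≥ {suc m} {j} f (s≤s j≤m) with m≤n⇒m<n∨m≡n j≤m
... | inj₁ j<m  = ≤-trans (sumTo-≥ f j<m) (m≤n+m _ (f m))
... | inj₂ refl = m≤m+n _ _

sumMap-sumTo : ∀ {A : Set} m (f : ℕ → A → ℕ) {c} xs → (∀ j → j < m → sumMap (f j) xs ≤ c) →
               sumMap (λ x → sumTo m (λ j → f j x)) xs ≤ m * c
sumMap-sumTo zero    f xs le = ≤-reflexive (sumMap-0 xs)
sumMap-sumTo (suc m) f xs le = ≤-trans (≤-reflexive (sumMap-+ (f m) (λ x → sumTo m (λ j → f j x)) xs))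
  (+-mono-≤ (le m ≤-refl) (sumMap-sumTo m f xs (λ j j<m → le j (m≤n⇒m≤1+n j<m))))

square-cancel-≤ : ∀ {a b} → a * a ≤ b * b → a ≤ b
square-cancel-≤ {a} {b} le = ≮⇒≥ (λ b<a → <⇒≱ (*-mono-< b<a b<a) le)

-- `t` is the integer part of √n / c; it rises by at most one when n does.
sqrt : ∀ c → 1 ≤ c → ∀ n → ∃ λ t → c * t * (c * t) ≤ n × n < c * suc t * (c * suc t)
sqrt c 1≤c zero    = 0 , ≤-reflexive (cong (λ z → z * z) (*-zeroʳ c)) ,
  *-mono-≤ {1} {c * 1} {1} {c * 1} (≤-trans 1≤c (≤-reflexive (sym (*-identityʳ c)))) (≤-trans 1≤c (≤-reflexive (sym (*-identityʳ c))))
sqrt c 1≤c (suc n) with sqrt c 1≤c n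
... | t , lo , hi with suc n <? c * suc t * (c * suc t)
...   | yes lt = t , m≤n⇒m≤1+n lo , lt
...   | no ¬lt = suc t , ≮⇒≥ ¬lt , ≤-<-trans hi (*-mono-< step step)
  where
    step : c * suc t < c * suc (suc t)
    step = *-monoʳ-< c {{>-nonZero 1≤c}} (n<1+n (suc t))

-- Large independent sets from letter counts.

module Independence (q : ℕ) where
  private
    p : ℕ
    p = suc (suc q)
  open ModularArithmetic p using (⟦_⟧; 0#; 1#; ⟦⟧-suc; ⟦p⟧≡0; -ₚ-def; +1-injective; module Solver)
    renaming (+-identityˡ to +ₚ-identityˡ; _+_ to _+ₚ_; _-_ to _-′_; +-comm to +ₚ-comm)
  open Solver using (solve; _:=_; _:+_; _:-_)
  open Walks q

  letter : ℕ → Fin p → ℕ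
  letter j x = bit (x +ₚ ⟦ j ⟧ ≟ᶠ 1#)

  Φ : ∀ {n} → ℕ → Vtx p n → ℕ
  Φ j []      = 0
  Φ j (x ∷ v) = letter j x + Φ j v

  x+0≡x : ∀ x → x +ₚ 0# ≡ x
  x+0≡x x = trans (+ₚ-comm x 0#) (+ₚ-identityˡ x)

  letter0-1 : letter 0 (fsuc fzero) ≡ 1
  letter0-1 = bit≡1 (_ ≟ᶠ _) (x+0≡x _)

  letter0-≢1 : ∀ x → x ≢ fsuc fzero → letter 0 x ≡ 0
  letter0-≢1 x x≢1 = bit≡0 (_ ≟ᶠ _) (λ eq → x≢1 (trans (sym (x+0≡x x)) eq))

  letter1-0 : letter 1 fzero ≡ 1
  letter1-0 = bit≡1 (_ ≟ᶠ _) (+ₚ-identityˡ 1#)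

  letter1-≢0 : ∀ x → x ≢ fzero → letter 1 x ≡ 0
  letter1-≢0 x x≢0 = bit≡0 (_ ≟ᶠ _) (λ eq → x≢0 (+1-injective (trans eq (sym (+ₚ-identityˡ 1#)))))

  words : ∀ n → List (Vtx p n)
  words zero    = [] ∷ []
  words (suc n) = cartesianProductWith _∷_ (allFin p) (words n)

  words-unique : ∀ n → Unique (words n)
  words-unique zero    = [] ∷ []
  words-unique (suc n) = Unique.cartesianProductWith⁺ _∷_ Vec.∷-injective (Unique.allFin⁺ p) (words-unique n)

  sumMap-cartesian : ∀ {n} (f : Vtx p (suc n) → ℕ) xs vs →
    sumMap f (cartesianProductWith _∷_ xs vs) ≡ sumMap (λ x → sumMap (f ∘ (x ∷_)) vs) xs
  sumMap-cartesian f []       vs = refl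
  sumMap-cartesian f (x ∷ xs) vs = begin
    sum (map f (map (x ∷_) vs ++ rest))             ≡⟨ cong sum (map-++ f (map (x ∷_) vs) rest) ⟩
    sum (map f (map (x ∷_) vs) ++ map f rest)       ≡⟨ sum-++ (map f (map (x ∷_) vs)) (map f rest) ⟩
    sum (map f (map (x ∷_) vs)) + sumMap f rest     ≡⟨ cong₂ _+_ (cong sum (sym (map-∘ vs))) (sumMap-cartesian f xs vs) ⟩
    sumMap (f ∘ (x ∷_)) vs + sumMap (λ x → sumMap (f ∘ (x ∷_)) vs) xs ∎
    where
      open ≡-Reasoning
      rest = cartesianProductWith _∷_ xs vs

  -- `Φ 0` counts ones and `Φ 1` counts zeros; the other q letters leave both fixed and give the
  -- lazy term of `walk`.
  walk-words : ∀ n g a b → sumMap (λ v → g (a + Φ 0 v) (b + Φ 1 v)) (words n) ≡ walk n g a b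
  walk-words zero    g a b = trans (+-identityʳ _) (cong₂ g (+-identityʳ a) (+-identityʳ b))
  walk-words (suc n) g a b = begin
    sumMap f (words (suc n))                  ≡⟨ sumMap-cartesian f (allFin p) (words n) ⟩
    sumMap F (allFin p)                       ≡⟨⟩
    F fzero + (F (fsuc fzero) + sumMap F others)
      ≡⟨ cong₂ _+_ (F-letter fzero (letter0-≢1 fzero (λ ())) letter1-0)
          (cong₂ _+_ (F-letter (fsuc fzero) letter0-1 (letter1-≢0 (fsuc fzero) (λ ())))
            (sumMap-constant (tabulate⁺ (λ i → F-letter (fsuc (fsuc i)) (letter0-≢1 _ (λ ())) (letter1-≢0 _ (λ ())))))) ⟩
    walk n g a (suc b) + (walk n g (suc a) b + length others * walk n g a b)
      ≡⟨ cong (λ l → walk n g a (suc b) + (walk n g (suc a) b + l * walk n g a b)) (length-tabulate {n = q} (λ i → fsuc (fsuc i))) ⟩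
    walk n g a (suc b) + (walk n g (suc a) b + q * walk n g a b)
      ≡⟨ lem (walk n g a (suc b)) (walk n g (suc a) b) (q * walk n g a b) ⟩
    walk n g (suc a) b + walk n g a (suc b) + q * walk n g a b ∎
    where
      open ≡-Reasoning
      f : Vtx p (suc n) → ℕ
      f v = g (a + Φ 0 v) (b + Φ 1 v)
      F : Fin p → ℕ
      F x = sumMap (f ∘ (x ∷_)) (words n)
      others : List (Fin p)
      others = tabulate (λ i → fsuc (fsuc i))

      lem : ∀ x y z → x + (y + z) ≡ y + x + z
      lem = solve-∀
      lem′ : ∀ a α φ → a + (α + φ) ≡ α + a + φ
      lem′ = solve-∀

      F-letter : ∀ x {α β} → letter 0 x ≡ α → letter 1 x ≡ β → F x ≡ walk n g (α + a) (β + b)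
      F-letter x refl refl = trans
        (sumMap-cong (λ v → cong₂ g (lem′ a (letter 0 x) (Φ 0 v)) (lem′ b (letter 1 x) (Φ 1 v))) (words n))
        (walk-words n g (letter 0 x + a) (letter 1 x + b))

  Φ-period : ∀ {n} (v : Vtx p n) → Φ p v ≡ Φ 0 v
  Φ-period []      = refl
  Φ-period (x ∷ v) = cong₂ _+_ (cong (λ y → bit (x +ₚ y ≟ᶠ 1#)) ⟦p⟧≡0) (Φ-period v)

  letter-shift : ∀ j {x y} → _-ₚ_ p x y ≡ 1# → letter j x ≡ letter (suc j) y
  letter-shift j {x} {y} eq = cong (λ z → bit (z ≟ᶠ 1#)) (begin
    x +ₚ ⟦ j ⟧             ≡⟨ solve 3 (λ x y j → x :+ j := y :+ (j :+ (x :- y))) refl x y ⟦ j ⟧ ⟩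
    y +ₚ (⟦ j ⟧ +ₚ (x -′ y)) ≡⟨ cong (λ z → y +ₚ (⟦ j ⟧ +ₚ z)) (trans (sym (-ₚ-def x y)) eq) ⟩
    y +ₚ (⟦ j ⟧ +ₚ 1#)     ≡⟨ cong (y +ₚ_) (⟦⟧-suc j) ⟨
    y +ₚ ⟦ suc j ⟧         ∎)
    where open ≡-Reasoning

  -- Where v - w is 1, the entry of v is 1 - j exactly when that of w is 1 - (j + 1). Each of the
  -- other d coordinates affects the comparison by at most one.
  Φ-shift : ∀ {n} j (v w : Vtx p n) → let d = ham p (_-ᵥ_ p v w) (𝟏 p n) in
            Φ j v ≤ Φ (suc j) w + d × Φ (suc j) w ≤ Φ j v + d
  Φ-shift j []      []      = z≤n , z≤n
  Φ-shift j (x ∷ v) (y ∷ w) with _-ₚ_ p x y ≟ᶠ 1# | Φ-shift j v w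
  ... | yes eq | le₁ , le₂ =
      ≤-trans (+-mono-≤ (≤-reflexive (letter-shift j eq)) le₁) (≤-reflexive (sym (+-assoc (letter (suc j) y) _ _)))
    , ≤-trans (+-mono-≤ (≤-reflexive (sym (letter-shift j eq))) le₂) (≤-reflexive (sym (+-assoc (letter j x) _ _)))
  ... | no _ | le₁ , le₂ = step (bit≤1 (x +ₚ ⟦ j ⟧ ≟ᶠ 1#)) le₁ , step (bit≤1 (y +ₚ ⟦ suc j ⟧ ≟ᶠ 1#)) le₂
    where
      step : ∀ {l l′ a b d} → l ≤ 1 → a ≤ b + d → l + a ≤ l′ + b + suc d
      step {l} {l′} {a} {b} {d} l≤1 a≤ = ≤-trans (+-mono-≤ l≤1 a≤) (≤-trans (≤-reflexive (sym (+-suc b d))) (+-monoˡ-≤ (suc d) (m≤n+m b l′)))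

  module _ (g : ℕ) where

    -- The required drop shrinks by `g` at each index, which leaves room for the error in
    -- `Steep-shift`; at j = 0 it is a lead of p g.
    Steep : ∀ {n} → ℕ → Vtx p n → Set
    Steep j v = Φ (suc j) v + (p ∸ j) * g ≤ Φ j v

    steep? : ∀ {n} j (v : Vtx p n) → Dec (Steep j v)
    steep? j v = Φ (suc j) v + (p ∸ j) * g ≤? Φ j v

    LastSteep : ∀ {n} → ℕ → Vtx p n → Set
    LastSteep j v = Steep j v × ¬ Steep (suc j) v

    lastSteep? : ∀ {n} j (v : Vtx p n) → Dec (LastSteep j v)
    lastSteep? j v = steep? j v ×-dec ¬? (steep? (suc j) v)

    -- The profile j ↦ Φ j v is p-periodic, so it cannot descend for p consecutive steps.
    lastSteep-exists : 1 ≤ g → ∀ {n} (v : Vtx p n) → Steep 0 v → ∃ λ j → j < p × LastSteep j v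
    lastSteep-exists 1≤g v steep₀ with descend (suc q)
      where
        -- The first drop loses p g and later ones never regain it, so arriving at m = p - 1 gives Φ
        -- p + p g ≤ Φ 0, against periodicity.
        descend : ∀ m → (Steep m v × Φ (suc m) v + p * g ≤ Φ 0 v) ⊎ (∃ λ j → j < m × LastSteep j v)
        descend zero = inj₁ (steep₀ , steep₀)
        descend (suc m) with descend m
        ... | inj₂ (j , j<m , last) = inj₂ (j , m≤n⇒m≤1+n j<m , last)
        ... | inj₁ (steep , le) with steep? (suc m) v
        ...   | no ¬steep  = inj₂ (m , ≤-refl , steep , ¬steep)
        ...   | yes steep′ = inj₁ (steep′ , ≤-trans (+-monoˡ-≤ (p * g) (m+n≤o⇒m≤o (Φ (suc (suc m)) v) steep′)) le)
    ... | inj₂ (j , j<m , last) = j , m≤n⇒m≤1+n j<m , last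
    ... | inj₁ (_ , le) = ⊥-elim (<⇒≱ {Φ 0 v} {Φ 0 v + p * g} (≤-trans (≤-reflexive (+-comm 1 (Φ 0 v))) (+-monoʳ-≤ (Φ 0 v) (*-mono-≤ {1} {p} (s≤s z≤n) 1≤g)))
            (subst (λ z → z + p * g ≤ Φ 0 v) (Φ-period v) le))

    -- Replacing v by w costs d at each of the two indices, and the threshold falls by g ≥ 2d.
    Steep-shift : ∀ {n} j (v w : Vtx p n) → j < p → 2 * ham p (_-ᵥ_ p v w) (𝟏 p n) ≤ g → Steep j v → Steep (suc j) w
    Steep-shift {n} j v w j<p 2d≤g steep = +-cancelʳ-≤ d _ _ (begin
      Φ (suc (suc j)) w + (p ∸ suc j) * g + d          ≤⟨ +-monoˡ-≤ d (+-monoˡ-≤ ((p ∸ suc j) * g) (proj₂ (Φ-shift (suc j) v w))) ⟩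
      Φ (suc j) v + d + (p ∸ suc j) * g + d            ≡⟨ lem (Φ (suc j) v) d ((p ∸ suc j) * g) ⟩
      Φ (suc j) v + (2 * d + (p ∸ suc j) * g)          ≤⟨ +-monoʳ-≤ (Φ (suc j) v) (+-monoˡ-≤ _ 2d≤g) ⟩
      Φ (suc j) v + (g + (p ∸ suc j) * g)              ≡⟨ cong (λ m → Φ (suc j) v + m * g) (+-∸-assoc 1 j<p) ⟨
      Φ (suc j) v + (p ∸ j) * g                        ≤⟨ steep ⟩
      Φ j v                                            ≤⟨ proj₁ (Φ-shift j v w) ⟩
      Φ (suc j) w + d                                  ∎)
      where
        open ≤-Reasoning
        d = ham p (_-ᵥ_ p v w) (𝟏 p n)
        lem : ∀ x d y → x + d + y + d ≡ x + (2 * d + y)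
        lem = solve-∀

    module _ {n : ℕ} (S-small : ∀ x → InS p n x → 2 * ham p x (𝟏 p n) ≤ g) where

      -- An arc between two members would carry steepness at j from its head to steepness at j + 1
      -- of its tail.
      lastSteep-independent : ∀ j → j < p → {v w : Vtx p n} → LastSteep j v → LastSteep j w → ¬ Adj p n v w
      lastSteep-independent j j<p {v} {w} (sv , ¬sv) (sw , ¬sw) (_ , inj₁ w-v∈S) = ¬sv (Steep-shift j w v j<p (S-small (_-ᵥ_ p w v) w-v∈S) sw)
      lastSteep-independent j j<p {v} {w} (sv , ¬sv) (sw , ¬sw) (_ , inj₂ v-w∈S) = ¬sw (Steep-shift j v w j<p (S-small (_-ᵥ_ p v w) v-w∈S) sv)

      lastSteep-set : ∀ j → j < p → HasIndependentSet p n (length (filter (lastSteep? j) (words n)))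
      lastSteep-set j j<p = lookup xs , lookup-injective (Unique.filter⁺ (lastSteep? j) (words-unique n)) ,
        λ i i′ → lastSteep-independent j j<p (holds i) (holds i′)
        where
          xs = filter (lastSteep? j) (words n)
          holds : ∀ i → LastSteep j (lookup xs i)
          holds i = proj₂ (∈-filter⁻ (lastSteep? j) {xs = words n} (∈-lookup {xs = xs} i))

      lead≤pα : 1 ≤ g → ∀ α → (∀ b → HasIndependentSet p n b → b ≤ α) → lead n (p * g) ≤ p * α
      lead≤pα 1≤g α max = begin
        lead n (p * g)                                       ≡⟨ walk-words n (ahead (p * g)) 0 0 ⟨
        sumMap (λ v → bit (steep? 0 v)) (words n)            ≤⟨ sumMap-mono pointwise (words n) ⟩
        sumMap (λ v → sumTo p (λ j → bit (lastSteep? j v))) (words n)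
          ≤⟨ sumMap-sumTo p (λ j v → bit (lastSteep? j v)) (words n)
               (λ j j<p → ≤-trans (≤-reflexive (length-filter-bit (lastSteep? j) (words n))) (max _ (lastSteep-set j j<p))) ⟩
        p * α ∎
        where
          open ≤-Reasoning
          pointwise : ∀ v → bit (steep? 0 v) ≤ sumTo p (λ j → bit (lastSteep? j v))
          pointwise v = bit-≤ (steep? 0 v) λ steep →
            let (j , j<p , last) = lastSteep-exists 1≤g v steep in
            ≤-trans (bit-yes (lastSteep? j v) last) (sumTo-≥ (λ j → bit (lastSteep? j v)) j<p)

  -- n ≥ (c t)² is cut into K blocks of 2 p t² coordinates and a remainder; a lead of t in every
  -- block occurs with probability at least (8 p)⁻ᴷ and yields a lead of K t.
  density : ∀ c K t n → 1 ≤ t → K * (2 * P * (t * t)) ≡ c * t * (c * t) → c * t * (c * t) ≤ n →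
            P ^ n ≤ (8 * P) ^ K * 2 * lead n (K * t)
  density c K t n 1≤t block≡ lo = begin
    P ^ n                                                    ≡⟨ cong (P ^_) n≡ ⟩
    P ^ (K * m + r)                                          ≡⟨ ^-distribˡ-+-* P (K * m) r ⟩
    P ^ (K * m) * P ^ r                                      ≤⟨ *-mono-≤ (lead-blocks K m t 1≤m ≤-refl) (lead-zero r) ⟩
    (8 * P) ^ K * lead (K * m) (K * t) * (2 * lead r 0)      ≡⟨ lem ((8 * P) ^ K) (lead (K * m) (K * t)) (lead r 0) ⟩
    (8 * P) ^ K * 2 * (lead (K * m) (K * t) * lead r 0)      ≤⟨ *-monoʳ-≤ ((8 * P) ^ K * 2) (lead-superadditive (K * m) r (K * t) 0) ⟩
    (8 * P) ^ K * 2 * lead (K * m + r) (K * t + 0)           ≡⟨ cong₂ (λ a b → (8 * P) ^ K * 2 * lead a b) (sym n≡) (+-identityʳ (K * t)) ⟩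
    (8 * P) ^ K * 2 * lead n (K * t)                         ∎
    where
      open ≤-Reasoning
      m r : ℕ
      m = 2 * P * (t * t)
      r = n ∸ c * t * (c * t)
      n≡ : n ≡ K * m + r
      n≡ = trans (sym (m+[n∸m]≡n lo)) (cong (_+ r) (sym block≡))
      1≤m : 1 ≤ m
      1≤m = *-mono-≤ {1} {2 * P} (s≤s z≤n) (*-mono-≤ 1≤t 1≤t)
      lem : ∀ x y z → x * y * (2 * z) ≡ x * 2 * (y * z)
      lem = solve-∀

  lead-antitone : ∀ n {s t} → s ≤ t → lead n t ≤ lead n s
  lead-antitone n {s} {t} s≤t = walk-mono n (λ a b → bit-mono (b + t ≤? a) (b + s ≤? a) (≤-trans (+-monoʳ-≤ b s≤t))) 0 0

  -- Chosen so that blockCount blocks of 2 P t² coordinates have exactly (scale * t)² coordinates,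
  -- while a lead of blockCount * t exceeds the P gaps 2 P (scale * (t + 1)).
  scale blockCount inverseDensity : ℕ
  scale          = 8 * (P * P * P)
  blockCount     = 32 * (P * P * P * P * P)
  inverseDensity = (8 * P) ^ blockCount * 2 * P + P ^ (scale * scale)

  1≤inverseDensity : 1 ≤ inverseDensity
  1≤inverseDensity = ≤-trans (m^n>0 P (scale * scale)) (m≤n+m (P ^ (scale * scale)) ((8 * P) ^ blockCount * 2 * P))

  module _ (n α : ℕ) (max : ∀ b → HasIndependentSet p n b → b ≤ α) where

    -- A single vertex is independent; this settles the small n.
    1≤α : 1 ≤ α
    1≤α = max 1 ((λ _ → Vec.replicate n fzero) , (λ { {fzero} {fzero} _ → refl }) , (λ { fzero fzero (u≢u , _) → u≢u refl }))

    -- If t = 0, then n < c² and P^(c²) already bounds the number of vertices. Otherwise (ct)² ≤ n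
    -- feeds the blocks, while n < (c(t + 1))² keeps S within distance g/2 of 𝟏.
    independence-bound : ∀ c K → 1 ≤ c → (∀ t → K * (2 * P * (t * t)) ≡ c * t * (c * t)) →
      (∀ t → 1 ≤ t → P * (2 * (P * (c * suc t))) ≤ K * t) →
      P ^ n ≤ ((8 * P) ^ K * 2 * P + P ^ (c * c)) * α
    independence-bound c K 1≤c blocks gap with sqrt c 1≤c n
    ... | zero , _ , hi = begin
      P ^ n                                        ≤⟨ ^-monoʳ-≤ P (<⇒≤ (subst (λ z → n < z * z) (*-identityʳ c) hi)) ⟩
      P ^ (c * c)                                  ≡⟨ *-identityʳ _ ⟨
      P ^ (c * c) * 1                              ≤⟨ *-mono-≤ (m≤n+m (P ^ (c * c)) ((8 * P) ^ K * 2 * P)) 1≤α ⟩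
      ((8 * P) ^ K * 2 * P + P ^ (c * c)) * α      ∎
      where open ≤-Reasoning
    ... | t@(suc _) , lo , hi = begin
      P ^ n                                        ≤⟨ density c K t n (s≤s z≤n) (blocks t) lo ⟩
      (8 * P) ^ K * 2 * lead n (K * t)             ≤⟨ *-monoʳ-≤ ((8 * P) ^ K * 2) (lead-antitone n (gap t (s≤s z≤n))) ⟩
      (8 * P) ^ K * 2 * lead n (P * g)             ≤⟨ *-monoʳ-≤ ((8 * P) ^ K * 2) (lead≤pα g S-small 1≤g α max) ⟩
      (8 * P) ^ K * 2 * (P * α)                    ≡⟨ *-assoc ((8 * P) ^ K * 2) P α ⟨
      (8 * P) ^ K * 2 * P * α                      ≤⟨ *-monoˡ-≤ α (m≤m+n ((8 * P) ^ K * 2 * P) (P ^ (c * c))) ⟩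
      ((8 * P) ^ K * 2 * P + P ^ (c * c)) * α      ∎
      where
        open ≤-Reasoning
        s g : ℕ
        s = c * suc t
        g = 2 * (P * s)

        1≤g : 1 ≤ g
        1≤g = *-mono-≤ {1} {2} (s≤s z≤n) (*-mono-≤ {1} {P} (s≤s z≤n) (*-mono-≤ {1} {c} {1} {suc t} 1≤c (s≤s z≤n)))

        S-small : ∀ x → InS p n x → 2 * ham p x (𝟏 p n) ≤ g
        S-small x x∈S = *-monoʳ-≤ 2 (square-cancel-≤ {d} {P * s} (begin
          d * d                ≡⟨ cong (d *_) (*-identityʳ d) ⟨
          d ^ 2                ≤⟨ x∈S ⟩
          P ^ 2 * n            ≤⟨ *-monoʳ-≤ (P ^ 2) (<⇒≤ hi) ⟩
          P ^ 2 * (s * s)      ≡⟨ lem₂ P s ⟩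
          P * s * (P * s)      ∎))
          where
            d = ham p x (𝟏 p n)
            lem₂ : ∀ P s → P * (P * 1) * (s * s) ≡ P * s * (P * s)
            lem₂ = solve-∀

    independence-density : P ^ n ≤ inverseDensity * α
    independence-density = independence-bound scale blockCount (s≤s z≤n) (blocks P) (gap P)
      where
        blocks : ∀ P t → 32 * (P * P * P * P * P) * (2 * P * (t * t)) ≡ 8 * (P * P * P) * t * (8 * (P * P * P) * t)
        blocks = solve-∀

        gap : ∀ P t → 1 ≤ t → P * (2 * (P * (8 * (P * P * P) * suc t))) ≤ 32 * (P * P * P * P * P) * t
        gap P t 1≤t = ≤-trans (≤-reflexive (lem₁ P t))
          -- Here t + 1 ≤ 2t, by 1 ≤ t.
          (≤-trans (*-monoʳ-≤ (16 * (P * P * P * P * P)) (+-monoˡ-≤ t 1≤t)) (≤-reflexive (lem₂ P t)))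
          where
            lem₁ : ∀ P t → P * (2 * (P * (8 * (P * P * P) * (1 + t)))) ≡ 16 * (P * P * P * P * P) * (1 + t)
            lem₁ = solve-∀
            lem₂ : ∀ P t → 16 * (P * P * P * P * P) * (t + t) ≡ 32 * (P * P * P * P * P) * t
            lem₂ = solve-∀

theorem1p5 : (p : ℕ) .{{_ : NonZero p}} → Prime p →
    ((n : ℕ) → 1 ≤ n → (χ : ℕ) → IsChromaticNumber p n χ →
    n ≤ (χ * p ^ 3) ^ 2)
    × Σ ℕ (λ a → Σ ℕ (λ b → 1 ≤ a × 1 ≤ b ×
    ((n : ℕ) → 1 ≤ n → (α : ℕ) → IsIndependenceNumber p n α →
    a * p ^ n ≤ b * α)))
theorem1p5 zero          p-prime = ⊥-elim (¬prime[0] p-prime)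
theorem1p5 (suc zero)    p-prime = ⊥-elim (¬prime[1] p-prime)
theorem1p5 (suc (suc q)) p-prime =
    (λ n 1≤n χ (colorable , _) → ChromaticNumber.chromatic-bound p p-prime n 1≤n χ colorable)
  -- The density constant c_p is 1 / `inverseDensity`.
  , 1 , inverseDensity , ≤-refl , 1≤inverseDensity
  , λ n _ α (_ , max) → ≤-trans (≤-reflexive (*-identityˡ (p ^ n))) (independence-density n α max)
  where
    open Independence q
    p = suc (suc q)
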